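{- Let $\mathcal{F}$ be a periodic infinite frieze of positive integers with growth coefficients $(s_k)_{k\ge0}$. The following are equivalent: (a) There exists $k>0$ such that $s_k=2$. (b) $s_k=2$ for all $k\ge0$. (c) $\mathcal{F}$ arises from a triangulation of a punctured disc.
   Context: An infinite frieze of positive integers is an array $(m_{i,j})$, indexed by $i\in\mathbb{Z}$ and $j\ge i-2$, with $m_{i,i-2}=0$, $m_{i,i-1}=1$, with $m_{i,j}$ a positive integer for $j\ge i-1$, and with $m_{i,j}m_{i+1,j+1}-m_{i,j+1}m_{i+1,j}=1$ for all $i$ and all $j\ge i-1$. It is periodic if for some $n\ge1$ one has $m_{i+n,j+n}=m_{i,j}$ for all entries. With $n$ the minimal such period, the growth coefficients are $s_0:=2$ and $s_k:=m_{1,kn}-m_{2,kn-1}$ for $k\ge1$. The quiddity row is $a_i=m_{i,i}$; a finite block of consecutive entries whose periodic repetition is the quiddity row is called a quiddity sequence of the frieze (its length is a period, not necessarily minimal). A triangulation of a punctured disc is a maximal collection of pairwise non-crossing (non-self-crossing) arcs, up to isotopy, in the once-punctured disc with $N\ge1$ marked points on its boundary, with endpoints in the set consisting of the marked points and the puncture, none of which is contractible or isotopic to a boundary segment (loops based at boundary marked points around the puncture are allowed). It gives the sequence $(a_1,\dots,a_N)$, where $a_i$ is the number of regions incident with the boundary marked point $i$, counted in a small neighbourhood of it (i.e. one plus the number of ends of arcs at $i$), marked points being taken in cyclic order. A periodic infinite frieze of positive integers arises from a triangulation of a punctured disc if it has a quiddity sequence obtained in this way. It is known (Baur–Parsons–Tschabold)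 that every such triangulation yields a periodic infinite frieze of positive integers, that triangulations of annuli do so likewise (for each boundary component), and that every periodic infinite frieze of positive integers arises from a triangulation of a punctured disc or of an annulus. -}

module Defs where

open import Data.Empty using (⊥)
open import Data.Fin as Fin using (Fin; toℕ)
open import Data.Integer using (ℤ; +_; 0ℤ; 1ℤ; _+_; _-_; _*_; _≤_; _<_)
open import Data.List using (List; []; _∷_; length; filter; concatMap)
open import Data.List.Membership.Propositional using (_∈_)
open import Data.List.Relation.Unary.Unique.Propositional using (Unique)
open import Data.Nat as ℕ using (ℕ; zero; suc; NonZero)
open import Data.Nat.DivMod using (_mod_)
open import Data.Product using (Σ-syntax; ∃-syntax; _×_)
open import Data.Sum using (_⊎_)
open import Relation.Binary.PropositionalEquality using (_≡_)
open import Relation.Nullary using (¬_)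

-- Only the entries m i j with i - 2 ≤ j belong to the array; the values of
-- m elsewhere are junk and are not constrained or used anywhere.
record InfiniteFrieze : Set where
  field
    m        : ℤ → ℤ → ℤ
    zeros    : ∀ i → m i (i - + 2) ≡ 0ℤ
    ones     : ∀ i → m i (i - 1ℤ) ≡ 1ℤ
    positive : ∀ i j → i - 1ℤ ≤ j → 0ℤ < m i j
    diamond  : ∀ i j → i - 1ℤ ≤ j →
               m i j * m (i + 1ℤ) (j + 1ℤ) - m i (j + 1ℤ) * m (i + 1ℤ) j ≡ 1ℤ

open InfiniteFrieze public

IsPeriod : InfiniteFrieze → ℕ → Set
IsPeriod F n =
  1 ℕ.≤ n × (∀ i j → i - + 2 ≤ j → m F (i + + n) (j + + n) ≡ m F i j)

IsMinimalPeriod : InfiniteFrieze → ℕ → Set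
IsMinimalPeriod F n = IsPeriod F n × (∀ n′ → IsPeriod F n′ → n ℕ.≤ n′)

growth : InfiniteFrieze → (n : ℕ) → ℕ → ℤ
growth F n zero      = + 2
growth F n k@(suc _) = m F 1ℤ (+ (k ℕ.* n)) - m F (+ 2) (+ (k ℕ.* n) - 1ℤ)

quiddityRow : InfiniteFrieze → ℤ → ℤ
quiddityRow F i = m F i i

IsQuidditySequence : InfiniteFrieze → (N : ℕ) → (Fin N → ℕ) → Set
IsQuidditySequence F N a =
  ∃[ p ] (∀ (t : ℤ) (i : Fin N) →
    quiddityRow F (p + + toℕ i + t * + N) ≡ + a i)

-- Curves in the once-punctured disc with N marked points on its boundary
-- (labelled by Fin N in cyclic order), up to homotopy fixing endpoints:
--   * bridging i joins the marked point i to the puncture;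
--   * peripheral i d starts at the marked point i and runs around the puncture
--     in the positive direction past d boundary segments, ending at i + d mod N.
-- As the fundamental group of the punctured disc is ℤ, each unoriented curve
-- between marked points is peripheral i d for exactly one (i , d), except that
-- d = 0 is the contractible curve at i.  A non-self-crossing curve with both
-- ends at the puncture is contractible, so these are omitted.
data Curve (N : ℕ) : Set where
  bridging   : (i : Fin N) → Curve N
  peripheral : (i : Fin N) (d : ℕ) → Curve N

data Contractible {N : ℕ} : Curve N → Set where
  constant : ∀ i → Contractible (peripheral i 0)

data BoundarySegment {N : ℕ} : Curve N → Set where
  segment : ∀ i → BoundarySegment (peripheral i 1)

-- Curves in the universal cover of the punctured disc, a half-plane with the
-- marked points at the integers of its boundary line and the puncture at
-- infinity: ray x joins x to infinity, chord x y joins x to y (x ≤ y).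
data Lifted : Set where
  ray   : ℤ → Lifted
  chord : ℤ → ℤ → Lifted

-- The lifts of a curve are indexed by the deck transformations x ↦ x + t * N.
lift : ∀ {N} → ℤ → Curve N → Lifted
lift {N} t (bridging i)     = ray (+ toℕ i + t * + N)
lift {N} t (peripheral i d) = chord x (x + + d)
  where x = + toℕ i + t * + N

-- Unavoidable intersection away from endpoints: the ends are linked.
LiftsCross : Lifted → Lifted → Set
LiftsCross (ray x)     (ray y)     = ⊥
LiftsCross (ray x)     (chord u v) = u < x × x < v
LiftsCross (chord u v) (ray x)     = u < x × x < v
LiftsCross (chord u v) (chord x y) =
  (u < x × x < v × v < y) ⊎ (x < u × u < y × y < v)

-- With a = b this says that the curve crosses itself.
Cross : ∀ {N} → Curve N → Curve N → Set
Cross a b = ∃[ s ] ∃[ t ] LiftsCross (lift s a) (lift t b)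

IsArc : ∀ {N} → Curve N → Set
IsArc c = ¬ Contractible c × ¬ BoundarySegment c × ¬ Cross c c

-- There are only finitely many arcs, so collections of arcs are finite and are
-- represented by duplicate-free lists.
record Triangulation (N : ℕ) : Set where
  field
    arcs        : List (Curve N)
    distinct    : Unique arcs
    areArcs     : ∀ {c} → c ∈ arcs → IsArc c
    nonCrossing : ∀ {a b} → a ∈ arcs → b ∈ arcs → ¬ Cross a b
    maximal     : ∀ c → IsArc c → (∀ {a} → a ∈ arcs → ¬ Cross c a) → c ∈ arcs

open Triangulation public

-- A loop at i contributes i twice.
boundaryEnds : ∀ {N} .{{_ : NonZero N}} → Curve N → List (Fin N)
boundaryEnds     (bridging i)     = i ∷ []
boundaryEnds {N} (peripheral i d) = i ∷ (toℕ i ℕ.+ d) mod N ∷ []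

-- The ends of arcs at i cut a small half-disc at i into one more sector than
-- there are ends; the sectors are the incidences of regions with i.
regionsAt : ∀ {N} .{{_ : NonZero N}} → Triangulation N → Fin N → ℕ
regionsAt T i = suc (length (filter (i Fin.≟_) (concatMap boundaryEnds (arcs T))))

ArisesFromPuncturedDisc : InfiniteFrieze → Set
ArisesFromPuncturedDisc F =
  Σ[ N ∈ ℕ ] Σ[ nz ∈ NonZero N ] Σ[ T ∈ Triangulation N ]
    IsQuidditySequence F N (regionsAt {{nz}} T)

{-# OPTIONS --safe #-}

-- Let a be the quiddity row and let D x y be the solution of
-- f (x - 1) + f (x + 1) = a x * f x in y with D x x = 0 and D x (x + 1) = 1, so
-- that m i j = D (i - 1) (j + 1).  For every multiple of the period, Cayley-Hamilton
-- for the monodromy of this recurrence involves the growth coefficient as its trace,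
-- and positivity forces the trace to be at least 2; this gives (a) ⇔ (b).
--
-- (c) ⇒ (a): lift the triangulation to the universal cover.  Telescoping the
-- recurrence along the fans of triangles shows that the values of a solution at
-- the successive marked points joined to the puncture form an arithmetic
-- progression, so the trace of a common period is 2.
--
-- (b) ⇒ (c): the chords are the pairs with D x y = 1.  By Plücker's relation they
-- do not cross.  For fixed x the fractions D (x - 1) y / D x y form a decreasing
-- chain of Farey neighbours, so counting the chords at x amounts to counting the
-- integers the chain passes.  As the trace is 2, the counts on the two sides of x
-- add up to a x or to a x + 1; in the first case x is joined to the puncture.
module Submission where

open import Data.Empty using (⊥; ⊥-elim)
open import Data.Fin as Fin using (Fin; toℕ; fromℕ<)
import Data.Fin.Properties as Fin
open import Data.Integer as ℤ hiding (suc; positive; NonZero; _>_)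
open import Data.Integer.DivMod using (n%ℕd<d; a≡a%ℕn+[a/ℕn]*n)
open import Data.Integer.Properties
open import Data.Integer.Tactic.RingSolver using (solve-∀)
open import Data.List using (List; []; _∷_; _++_; length; filter; concatMap; map; allFin; upTo; cartesianProductWith; deduplicate)
open import Data.List.Membership.Propositional using (_∈_)
open import Data.List.Membership.Propositional.Properties
  using (∈-filter⁺; ∈-filter⁻; ∈-deduplicate⁺; ∈-deduplicate⁻; ∈-++⁺ˡ; ∈-++⁺ʳ; ∈-map⁺; ∈-allFin; ∈-upTo⁺; ∈-cartesianProductWith⁺)
import Data.List.Membership.DecPropositional as DecMembership
open import Data.List.Relation.Unary.All as All using (All; []; _∷_)
open import Data.List.Relation.Unary.AllPairs using ([]; _∷_)
open import Data.List.Relation.Unary.Any using (here; there)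
open import Data.List.Relation.Unary.Unique.Propositional using (Unique)
import Data.List.Relation.Unary.Unique.DecPropositional.Properties as Unique
open import Data.Nat as ℕ using (ℕ; zero; suc; NonZero; _>_)
open import Data.Nat.DivMod using (_mod_)
import Data.Nat.Properties as ℕ
open import Data.Product using (∃-syntax; _×_; _,_; proj₁; proj₂)
open import Data.Sum using (_⊎_; inj₁; inj₂)
open import Function.Bundles using (_⇔_; mk⇔)
open import Relation.Binary.Definitions using (tri<; tri≈; tri>; DecidableEquality)
open import Relation.Binary.PropositionalEquality
open import Relation.Nullary using (¬_; Dec; yes; no)
open import Relation.Nullary.Decidable using (map′; _×-dec_; _⊎-dec_; decidable-stable)
open import Defs

-- Integers and finite sums

-- The entry `D x y` behaves like a lambda length between `x` and `y`, and trace 2 is what makes the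
-- puncture visible: the shift by a period then has eigenvalue 1, and the fixed solution `h` plays
-- the role of the length to infinity. Rays and chords are kept apart by Plücker's relation with one
-- point at infinity. The dichotomy between `a x` and `a x + 1` has its origin in the identity
-- `P + Q = a x * W + 2`, where `P / W` and `Q / W` are the fractions reached after one period on
-- the right and on the left of `x`, and the constant is the trace. The obstacle is maximality:
-- every pair that is not a chord must be shown to be crossed. This is settled locally. Neighbouring
-- chords at `x` close up to a triangle, and so do the outermost chords on the two sides of `x`
-- unless `x` is joined to the puncture. Both facts require the exact numerators at the chords,
-- which is why the chain of fractions is followed through its ceilings.

0≤+ : ∀ {i j} → 0ℤ ≤ i → 0ℤ ≤ j → 0ℤ ≤ i + j
0≤+ = +-mono-≤

0≤* : ∀ {i j} → 0ℤ ≤ i → 0ℤ ≤ j → 0ℤ ≤ i * j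
0≤* {i} {j} p q = subst (_≤ i * j) (*-zeroʳ i)
  (*-monoˡ-≤-nonNeg i {{nonNegative p}} q)

0<* : ∀ {i j} → 0ℤ < i → 0ℤ < j → 0ℤ < i * j
0<* {i} {j} p q = subst (_< i * j) (*-zeroʳ i) (*-monoˡ-<-pos i {{ℤ.positive p}} q)

-- Inequalities are handled by certificates: a strict hypothesis becomes a nonnegative
-- `j - (1ℤ + i)`, and a ring identity equates a nonnegative combination of such terms with the gap
-- of the goal, or with `-1ℤ` for a contradiction.
gap≥0 : ∀ {i j} → i < j → 0ℤ ≤ j - (1ℤ + i)
gap≥0 p = i≤j⇒0≤j-i (i<j⇒suc[i]≤j p)

gap≥0⇒< : ∀ {i j} → 0ℤ ≤ j - (1ℤ + i) → i < j
gap≥0⇒< p = suc[i]≤j⇒i<j (0≤i-j⇒j≤i p)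

0≤-resp : ∀ {i j} → i ≡ j → 0ℤ ≤ i → 0ℤ ≤ j
0≤-resp = subst (0ℤ ≤_)

0≰-1 : ¬ 0ℤ ≤ -1ℤ
0≰-1 ()

cancelˡ-pos : ∀ {i j k} → 0ℤ < i → i * j ≡ i * k → j ≡ k
cancelˡ-pos {i} p = *-cancelˡ-≡ i _ _ {{ℤ.>-nonZero p}}

pos-factorˡ : ∀ {i j} → 0ℤ < i → 0ℤ < i * j → 0ℤ < j
pos-factorˡ {i} {j} p q = *-cancelˡ-<-nonNeg i {{nonNegative (<⇒≤ p)}}
  (subst (_< i * j) (sym (*-zeroʳ i)) q)

nonneg-factorˡ : ∀ {i j} → 0ℤ < i → 0ℤ ≤ i * j → 0ℤ ≤ j
nonneg-factorˡ {i} {j} p q = *-cancelˡ-≤-pos 0ℤ j i {{ℤ.positive p}}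
  (subst (_≤ i * j) (sym (*-zeroʳ i)) q)

<-≤-connex : ∀ x y → x < y ⊎ y ≤ x
<-≤-connex x y with x <? y
... | yes x<y = inj₁ x<y
... | no  x≮y = inj₂ (≮⇒≥ x≮y)

<-gap : ∀ {x y} → x < y → ∃[ k ] y ≡ x + + suc k
<-gap {x} {y} x<y = k , trans (ring x y) (cong (λ d → x + (1ℤ + d)) (sym eq))
  where
  d = y - (1ℤ + x)
  k = ∣ d ∣
  eq : + k ≡ d
  eq = 0≤i⇒+∣i∣≡i (gap≥0 x<y)
  ring : ∀ x y → y ≡ x + (1ℤ + (y - (1ℤ + x)))
  ring = solve-∀

≤-gap : ∀ {x y} → x ≤ y → ∃[ k ] y ≡ x + + k
≤-gap {x} {y} x≤y = ∣ y - x ∣ ,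
  trans (ring x y) (cong (λ d → x + d) (sym (0≤i⇒+∣i∣≡i (i≤j⇒0≤j-i x≤y))))
  where
  ring : ∀ x y → y ≡ x + (y - x)
  ring = solve-∀

x<x+suc : ∀ x k → x < x + + suc k
x<x+suc x k = subst (_< x + + suc k) (+-identityʳ x) (+-monoʳ-< x (+<+ (ℕ.s≤s ℕ.z≤n)))

shift-< : ∀ x {j k} → j ℕ.< k → x + + j < x + + k
shift-< x p = +-monoʳ-< x (+<+ p)

shift-≤ : ∀ x {j k} → j ℕ.≤ k → x + + j ≤ x + + k
shift-≤ x p = +-monoʳ-≤ x (+≤+ p)

unshift-< : ∀ x {j k} → x + + j < x + + k → j ℕ.< k
unshift-< x {j} {k} p = drop‿+<+ (subst₂ _<_ (ring x (+ j)) (ring x (+ k)) (+-monoʳ-< (- x) p))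
  where
  ring : ∀ x j → - x + (x + j) ≡ j
  ring = solve-∀

ℤ-induction : (P : ℤ → Set) → P 0ℤ → (∀ x → P x → P (x + 1ℤ)) →
  (∀ x → P (x + 1ℤ) → P x) → ∀ x → P x
ℤ-induction P z up down (+ zero) = z
ℤ-induction P z up down (+ suc k) =
  subst P (+-comm (+ k) 1ℤ) (up (+ k) (ℤ-induction P z up down (+ k)))
ℤ-induction P z up down -[1+ zero ] = down -[1+ zero ] z
ℤ-induction P z up down -[1+ suc k ] =
  down -[1+ suc k ] (ℤ-induction P z up down -[1+ k ])

-- Sum of g d over 1 ≤ d ≤ k.
sumTo : (ℕ → ℤ) → ℕ → ℤ
sumTo g zero    = 0ℤ
sumTo g (suc k) = sumTo g k + g (suc k)

sumTo-cong : ∀ {g h} k → (∀ d → 1 ℕ.≤ d → d ℕ.≤ k → g d ≡ h d) → sumTo g k ≡ sumTo h k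
sumTo-cong zero    e = refl
sumTo-cong (suc k) e = cong₂ _+_
  (sumTo-cong k λ d p q → e d p (ℕ.m≤n⇒m≤1+n q)) (e (suc k) (ℕ.s≤s ℕ.z≤n) ℕ.≤-refl)

sumTo-+ : ∀ g h k → sumTo (λ d → g d + h d) k ≡ sumTo g k + sumTo h k
sumTo-+ g h zero    = refl
sumTo-+ g h (suc k) rewrite sumTo-+ g h k =
  ring (sumTo g k) (sumTo h k) (g (suc k)) (h (suc k))
  where
  ring : ∀ a b c d → a + b + (c + d) ≡ a + c + (b + d)
  ring = solve-∀

sumTo-split : ∀ g j k → sumTo g (j ℕ.+ k) ≡ sumTo g j + sumTo (λ d → g (j ℕ.+ d)) k
sumTo-split g j zero    = trans (cong (sumTo g) (ℕ.+-identityʳ j)) (sym (+-identityʳ _))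
sumTo-split g j (suc k) = trans (cong (sumTo g) (ℕ.+-suc j k))
  (trans (cong₂ _+_ (sumTo-split g j k) (cong g (sym (ℕ.+-suc j k)))) (+-assoc (sumTo g j) _ _))

sumTo-zero : ∀ g k → (∀ d → 1 ℕ.≤ d → d ℕ.≤ k → g d ≡ 0ℤ) → sumTo g k ≡ 0ℤ
sumTo-zero g zero    e = refl
sumTo-zero g (suc k) e = cong₂ _+_
  (sumTo-zero g k λ d p q → e d p (ℕ.m≤n⇒m≤1+n q)) (e (suc k) (ℕ.s≤s ℕ.z≤n) ℕ.≤-refl)

sumTo-tail : ∀ g {j k} → j ℕ.≤ k → (∀ d → j ℕ.< d → d ℕ.≤ k → g d ≡ 0ℤ) → sumTo g k ≡ sumTo g j
sumTo-tail g {j} {k} j≤k e with k ℕ.∸ j | ℕ.m+[n∸m]≡n j≤k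
... | r | refl = trans (sumTo-split g j r) (trans (cong (λ d → sumTo g j + d)
  (sumTo-zero _ r λ d p q → e (j ℕ.+ d) (ℕ.m<m+n j p) (ℕ.+-monoʳ-≤ j q))) (+-identityʳ _))

𝟙 : ∀ {P : Set} → Dec P → ℤ
𝟙 (yes _) = 1ℤ
𝟙 (no _)  = 0ℤ

𝟙-yes : ∀ {P : Set} (d : Dec P) → P → 𝟙 d ≡ 1ℤ
𝟙-yes (yes _) p = refl
𝟙-yes (no n)  p = ⊥-elim (n p)

𝟙-no : ∀ {P : Set} (d : Dec P) → ¬ P → 𝟙 d ≡ 0ℤ
𝟙-no (yes p) n = ⊥-elim (n p)
𝟙-no (no _)  n = refl

𝟙-cong : ∀ {P Q : Set} (d : Dec P) (e : Dec Q) → (P → Q) → (Q → P) → 𝟙 d ≡ 𝟙 e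
𝟙-cong (yes p) e f g = sym (𝟙-yes e (f p))
𝟙-cong (no n)  e f g = sym (𝟙-no e λ q → n (g q))

-- Nearest indices satisfying a decidable predicate

module _ {P : ℕ → Set} (P? : ∀ k → Dec (P k)) where

  lastBelow : ∀ {j₀} k → P j₀ → j₀ ℕ.< k →
    ∃[ j ] (j₀ ℕ.≤ j × j ℕ.< k × P j × (∀ i → j ℕ.< i → i ℕ.< k → ¬ P i))
  lastBelow {j₀} (suc k) p j₀≤k with P? k
  ... | yes q = k , ℕ.≤-pred j₀≤k , ℕ.≤-refl , q ,
    λ i k<i i≤k → ⊥-elim (ℕ.<-irrefl refl (ℕ.<-≤-trans k<i (ℕ.≤-pred i≤k)))
  ... | no ¬q with ℕ.m≤n⇒m<n∨m≡n (ℕ.≤-pred j₀≤k)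
  ...   | inj₂ refl = ⊥-elim (¬q p)
  ...   | inj₁ j₀<k with lastBelow k p j₀<k
  ...     | j , j₀≤j , j<k , q , none = j , j₀≤j , ℕ.m<n⇒m<1+n j<k , q , none′
    where
    none′ : ∀ i → j ℕ.< i → i ℕ.< suc k → ¬ P i
    none′ i j<i i≤k with ℕ.m≤n⇒m<n∨m≡n (ℕ.≤-pred i≤k)
    ... | inj₁ i<k  = none i j<i i<k
    ... | inj₂ refl = ¬q

  firstAbove : ∀ k r →
    (∃[ j ] (k ℕ.< j × j ℕ.≤ k ℕ.+ r × P j × (∀ i → k ℕ.< i → i ℕ.< j → ¬ P i)))
    ⊎ (∀ i → k ℕ.< i → i ℕ.≤ k ℕ.+ r → ¬ P i)
  firstAbove k zero = inj₂ λ i k<i i≤k → ⊥-elim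
    (ℕ.<-irrefl refl (ℕ.<-≤-trans k<i (subst (i ℕ.≤_) (ℕ.+-identityʳ k) i≤k)))
  firstAbove k (suc r) with firstAbove k r
  ... | inj₁ (j , k<j , j≤ , p , none) = inj₁ (j , k<j , ℕ.≤-trans j≤ (ℕ.+-monoʳ-≤ k (ℕ.n≤1+n r)) , p , none)
  ... | inj₂ none with P? (k ℕ.+ suc r)
  ...   | yes p = inj₁ (_ , ℕ.m<m+n k (ℕ.s≤s ℕ.z≤n) , ℕ.≤-refl , p ,
            λ i k<i i<j → none i k<i (ℕ.≤-pred (subst (i ℕ.<_) (ℕ.+-suc k r) i<j)))
  ...   | no ¬p = inj₂ none′
    where
    none′ : ∀ i → k ℕ.< i → i ℕ.≤ k ℕ.+ suc r → ¬ P i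
    none′ i k<i i≤ with ℕ.m≤n⇒m<n∨m≡n i≤
    ... | inj₁ i<   = none i k<i (ℕ.≤-pred (subst (i ℕ.<_) (ℕ.+-suc k r) i<))
    ... | inj₂ refl = ¬p

-- The recurrence of a quiddity row

i+1-1≡i : ∀ i → i + 1ℤ - 1ℤ ≡ i
i+1-1≡i = solve-∀

i-1+1≡i : ∀ i → i - 1ℤ + 1ℤ ≡ i
i-1+1≡i = solve-∀

module Recurrence (a : ℤ → ℤ) where

  Solution : (ℤ → ℤ) → Set
  Solution f = ∀ x → f (x - 1ℤ) + f (x + 1ℤ) ≡ a x * f x

  next : ∀ {f} → Solution f → ∀ x → f (x + 1ℤ + 1ℤ) ≡ a (x + 1ℤ) * f (x + 1ℤ) - f x
  next {f} sol x = begin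
    f (x + 1ℤ + 1ℤ)                                 ≡⟨ ring (f x) (f (x + 1ℤ + 1ℤ)) ⟩
    f x + f (x + 1ℤ + 1ℤ) - f x                     ≡⟨ cong (λ z → f z + f (x + 1ℤ + 1ℤ) - f x) (sym (i+1-1≡i x)) ⟩
    f (x + 1ℤ - 1ℤ) + f (x + 1ℤ + 1ℤ) - f x         ≡⟨ cong (_- f x) (sol (x + 1ℤ)) ⟩
    a (x + 1ℤ) * f (x + 1ℤ) - f x                   ∎
    where
    open ≡-Reasoning
    ring : ∀ u v → v ≡ u + v - u
    ring = solve-∀

  step : ℤ → ℤ × ℤ → ℤ × ℤ
  step x (u , v) = v , a x * v - u

  unstep : ℤ → ℤ × ℤ → ℤ × ℤ
  unstep x (u , v) = a x * u - v , u

  step-unstep : ∀ x s → step x (unstep x s) ≡ s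
  step-unstep x (u , v) = cong (u ,_) (ring (a x) u v)
    where
    ring : ∀ a u v → a * u - (a * u - v) ≡ v
    ring = solve-∀

  -- At `x` the state is the pair of values at `x` and at `x + 1ℤ`. Going down inverts the step at
  -- the upper index, so that the recurrence also holds across 0.
  state : ℤ × ℤ → ℤ → ℤ × ℤ
  state s (+ zero)      = s
  state s (+ suc k)     = step (+ suc k) (state s (+ k))
  state s -[1+ zero ]   = unstep 0ℤ s
  state s -[1+ suc k ]  = unstep -[1+ k ] (state s -[1+ k ])

  state-step : ∀ s x → state s (1ℤ + x) ≡ step (1ℤ + x) (state s x)
  state-step s (+ k)         = refl
  state-step s -[1+ zero ]   = sym (step-unstep 0ℤ s)
  state-step s -[1+ suc k ]  = sym (step-unstep -[1+ k ] _)

  solution : ℤ × ℤ → ℤ → ℤ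
  solution s x = proj₁ (state s x)

  state-step′ : ∀ s x → state s (x + 1ℤ) ≡ step (x + 1ℤ) (state s x)
  state-step′ s x = subst (λ z → state s z ≡ step z (state s x)) (+-comm 1ℤ x) (state-step s x)

  solution-next : ∀ s x → solution s (x + 1ℤ) ≡ proj₂ (state s x)
  solution-next s x = cong proj₁ (state-step′ s x)

  solution-sol : ∀ s → Solution (solution s)
  solution-sol s x = begin
    solution s y + solution s (x + 1ℤ)                     ≡⟨ cong (λ z → u + solution s (z + 1ℤ)) (sym (i-1+1≡i x)) ⟩
    u + solution s (y + 1ℤ + 1ℤ)                           ≡⟨ cong (λ v → u + v) (solution-next s (y + 1ℤ)) ⟩
    u + proj₂ (state s (y + 1ℤ))                           ≡⟨ cong (λ t → u + proj₂ t) (state-step′ s y) ⟩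
    u + (a (y + 1ℤ) * proj₂ (state s y) - u)               ≡⟨ ring u (a (y + 1ℤ) * proj₂ (state s y)) ⟩
    a (y + 1ℤ) * proj₂ (state s y)                         ≡⟨ cong (λ v → a (y + 1ℤ) * v) (sym (solution-next s y)) ⟩
    a (y + 1ℤ) * solution s (y + 1ℤ)                       ≡⟨ cong (λ z → a z * solution s z) (i-1+1≡i x) ⟩
    a x * solution s x                                     ∎
    where
    open ≡-Reasoning
    y = x - 1ℤ
    u = solution s y
    ring : ∀ u v → u + (v - u) ≡ v
    ring = solve-∀

  solution-unique : ∀ {f g} → Solution f → Solution g → f 0ℤ ≡ g 0ℤ → f 1ℤ ≡ g 1ℤ → ∀ x → f x ≡ g x
  solution-unique {f} {g} F G e₀ e₁ x = proj₁ (ℤ-induction P (e₀ , e₁) up down x)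
    where
    P : ℤ → Set
    P x = f x ≡ g x × f (x + 1ℤ) ≡ g (x + 1ℤ)
    up : ∀ x → P x → P (x + 1ℤ)
    up x (e , e′) = e′ , trans (next F x) (trans (cong₂ (λ u v → a (x + 1ℤ) * u - v) e′ e) (sym (next G x)))
    down : ∀ x → P (x + 1ℤ) → P x
    down x (e′ , e″) = cancel , e′
      where
      lem : ∀ u v → v ≡ u - (u - v)
      lem = solve-∀
      cancel : f x ≡ g x
      cancel = begin
        f x                                                      ≡⟨ lem (a (x + 1ℤ) * f (x + 1ℤ)) (f x) ⟩
        a (x + 1ℤ) * f (x + 1ℤ) - (a (x + 1ℤ) * f (x + 1ℤ) - f x) ≡⟨ cong₂ (λ u v → a (x + 1ℤ) * u - v) e′ (trans (sym (next F x)) (trans e″ (next G x))) ⟩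
        a (x + 1ℤ) * g (x + 1ℤ) - (a (x + 1ℤ) * g (x + 1ℤ) - g x) ≡⟨ sym (lem (a (x + 1ℤ) * g (x + 1ℤ)) (g x)) ⟩
        g x                                                      ∎
        where open ≡-Reasoning

  combination : ∀ {f g} c d → Solution f → Solution g → Solution (λ x → c * f x + d * g x)
  combination {f} {g} c d F G x = trans (ring c d (f (x - 1ℤ)) (f (x + 1ℤ)) (g (x - 1ℤ)) (g (x + 1ℤ)))
    (trans (cong₂ (λ u v → c * u + d * v) (F x) (G x)) (ring′ c d (a x) (f x) (g x)))
    where
    ring : ∀ c d p q r s → c * p + d * r + (c * q + d * s) ≡ c * (p + q) + d * (r + s)
    ring = solve-∀
    ring′ : ∀ c d a u v → c * (a * u) + d * (a * v) ≡ a * (c * u + d * v)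
    ring′ = solve-∀

  -- The basis of solutions dual to evaluation at 1 (`p`) and at 0 (`q`).
  p q : ℤ → ℤ
  p = solution (0ℤ , 1ℤ)
  q = solution (1ℤ , 0ℤ)

  p-sol : Solution p
  p-sol = solution-sol _
  q-sol : Solution q
  q-sol = solution-sol _

  expand₀ : ∀ {f} → Solution f → ∀ x → f x ≡ f 0ℤ * q x + f 1ℤ * p x
  expand₀ {f} F = solution-unique F (combination (f 0ℤ) (f 1ℤ) q-sol p-sol)
    (ring (f 0ℤ) (f 1ℤ)) (ring′ (f 0ℤ) (f 1ℤ))
    where
    ring : ∀ u v → u ≡ u * 1ℤ + v * 0ℤ
    ring = solve-∀
    ring′ : ∀ u v → v ≡ u * 0ℤ + v * 1ℤ
    ring′ = solve-∀

  opaque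

    -- The determinant of the vectors `(q , p)` at `x` and at `y`. Outside this block only the
    -- identities proved in it are used, not the choice of basis.
    D : ℤ → ℤ → ℤ
    D x y = q x * p y - p x * q y

    D-diag : ∀ x → D x x ≡ 0ℤ
    D-diag x = ring (q x) (p x)
      where
      ring : ∀ q p → q * p - p * q ≡ 0ℤ
      ring = solve-∀

    D-anti : ∀ x y → D y x ≡ - D x y
    D-anti x y = ring (q x) (p y) (p x) (q y)
      where
      ring : ∀ a b c d → d * c - b * a ≡ - (a * b - c * d)
      ring = solve-∀

    D-solʳ : ∀ x → Solution (D x)
    D-solʳ x y = trans (ring (q x) (p x) (p (y - 1ℤ)) (p (y + 1ℤ)) (q (y - 1ℤ)) (q (y + 1ℤ)))
      (trans (cong₂ (λ u v → q x * u - p x * v) (p-sol y) (q-sol y)) (ring′ (q x) (p x) (a y) (p y) (q y)))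
      where
      ring : ∀ q p a b c d → q * a - p * c + (q * b - p * d) ≡ q * (a + b) - p * (c + d)
      ring = solve-∀
      ring′ : ∀ q p a u v → q * (a * u) - p * (a * v) ≡ a * (q * u - p * v)
      ring′ = solve-∀

    D-solˡ : ∀ y → Solution (λ x → D x y)
    D-solˡ y x = begin
      D (x - 1ℤ) y + D (x + 1ℤ) y       ≡⟨ cong₂ _+_ (D-anti y (x - 1ℤ)) (D-anti y (x + 1ℤ)) ⟩
      - D y (x - 1ℤ) + - D y (x + 1ℤ)   ≡⟨ sym (neg-distrib-+ (D y (x - 1ℤ)) (D y (x + 1ℤ))) ⟩
      - (D y (x - 1ℤ) + D y (x + 1ℤ))   ≡⟨ cong -_ (D-solʳ y x) ⟩
      - (a x * D y x)                   ≡⟨ neg-distribʳ-* (a x) (D y x) ⟩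
      a x * - D y x                     ≡⟨ cong (λ v → a x * v) (sym (D-anti y x)) ⟩
      a x * D x y                       ∎
      where open ≡-Reasoning

    -- The discrete Wronskian is constant, as one step of the recurrence has determinant 1.
    D-adj : ∀ x → D x (x + 1ℤ) ≡ 1ℤ
    D-adj = ℤ-induction (λ x → D x (x + 1ℤ) ≡ 1ℤ) refl
      (λ x e → trans (shift x) e) (λ x e → trans (sym (shift x)) e)
      where
      ring : ∀ a p q p′ q′ → q′ * (a * p′ - p) - p′ * (a * q′ - q) ≡ q * p′ - p * q′
      ring = solve-∀
      shift : ∀ x → D (x + 1ℤ) (x + 1ℤ + 1ℤ) ≡ D x (x + 1ℤ)
      shift x = trans
        (cong₂ (λ u v → q (x + 1ℤ) * u - p (x + 1ℤ) * v) (next p-sol x) (next q-sol x))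
        (ring (a (x + 1ℤ)) (p x) (q x) (p (x + 1ℤ)) (q (x + 1ℤ)))

    plücker : ∀ x y z w → D x z * D y w ≡ D x y * D z w + D x w * D y z
    plücker x y z w = ring (q x) (p x) (q y) (p y) (q z) (p z) (q w) (p w)
      where
      ring : ∀ a a′ b b′ c c′ d d′ →
        (a * c′ - a′ * c) * (b * d′ - b′ * d) ≡
        (a * b′ - a′ * b) * (c * d′ - c′ * d) + (a * d′ - a′ * d) * (b * c′ - b′ * c)
      ring = solve-∀

    -- The Plücker relation with one point replaced by an arbitrary solution.
    three-term : ∀ {f} → Solution f → ∀ x y z → D x z * f y ≡ D x y * f z + D y z * f x
    three-term {f} F x y z = begin
      D x z * f y                       ≡⟨ cong (λ v → D x z * v) (expand₀ F y) ⟩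
      D x z * g y                       ≡⟨ ring (f 0ℤ) (f 1ℤ) (q x) (p x) (q y) (p y) (q z) (p z) ⟩
      D x y * g z + D y z * g x         ≡⟨ cong₂ (λ u v → D x y * u + D y z * v) (sym (expand₀ F z)) (sym (expand₀ F x)) ⟩
      D x y * f z + D y z * f x         ∎
      where
      open ≡-Reasoning
      g : ℤ → ℤ
      g x = f 0ℤ * q x + f 1ℤ * p x
      ring : ∀ s t a a′ b b′ c c′ →
        (a * c′ - a′ * c) * (s * b + t * b′) ≡
        (a * b′ - a′ * b) * (s * c + t * c′) + (b * c′ - b′ * c) * (s * a + t * a′)
      ring = solve-∀

  D-adj² : ∀ x → D (x - 1ℤ) (x + 1ℤ) ≡ a x
  D-adj² x = trans (ring (D (x - 1ℤ) (x - 1ℤ)) (D (x - 1ℤ) (x + 1ℤ)) (D-diag (x - 1ℤ)))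
    (trans (D-solʳ (x - 1ℤ) x) (trans (cong (λ z → a x * D (x - 1ℤ) z) (sym (i-1+1≡i x)))
      (trans (cong (λ v → a x * v) (D-adj (x - 1ℤ))) (*-identityʳ (a x)))))
    where
    ring : ∀ u v → u ≡ 0ℤ → v ≡ u + v
    ring u v refl = sym (+-identityˡ v)

  module Periodic (L : ℕ) (a-periodic : ∀ x → a (x + + L) ≡ a x) where

    Λ : ℤ
    Λ = + L

    shift-sol : ∀ {f} → Solution f → Solution (λ x → f (x + Λ))
    shift-sol {f} F x = trans
      (cong₂ (λ u v → f u + f v) (ring x (- 1ℤ) Λ) (ring x 1ℤ Λ))
      (trans (F (x + Λ)) (cong (_* f (x + Λ)) (a-periodic x)))
      where
      ring : ∀ x t l → x + t + l ≡ x + l + t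
      ring = solve-∀

    -- As functions of `y` both sides are solutions with the values 0 and 1 at `x` and `x + 1ℤ`; the
    -- three-term relation turns this into equality.
    D-shift : ∀ x y → D (x + Λ) (y + Λ) ≡ D x y
    D-shift x y = begin
      f y                                    ≡⟨ sym (*-identityˡ (f y)) ⟩
      1ℤ * f y                               ≡⟨ cong (_* f y) (sym (D-adj x)) ⟩
      D x (x + 1ℤ) * f y                     ≡⟨ three-term {f} (shift-sol (D-solʳ (x + Λ))) x y (x + 1ℤ) ⟩
      D x y * f (x + 1ℤ) + D y (x + 1ℤ) * f x ≡⟨ cong₂ (λ u v → D x y * u + D y (x + 1ℤ) * v) f-next (D-diag (x + Λ)) ⟩
      D x y * 1ℤ + D y (x + 1ℤ) * 0ℤ         ≡⟨ ring (D x y) (D y (x + 1ℤ)) ⟩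
      D x y                                  ∎
      where
      open ≡-Reasoning
      f : ℤ → ℤ
      f y = D (x + Λ) (y + Λ)
      swap : ∀ x l → x + 1ℤ + l ≡ x + l + 1ℤ
      swap = solve-∀
      f-next : f (x + 1ℤ) ≡ 1ℤ
      f-next = trans (cong (D (x + Λ)) (swap x Λ)) (D-adj (x + Λ))
      ring : ∀ u v → u * 1ℤ + v * 0ℤ ≡ u
      ring = solve-∀

    -- A solution is determined by its values at `y` and `y + 1ℤ`. This is the trace of the matrix
    -- sending this pair to the pair one period later.
    trace : ℤ → ℤ
    trace y = D y (y + Λ + 1ℤ) - D (y + 1ℤ) (y + Λ)

    -- For the shift `M` by one period, which has determinant 1, this is `M + M⁻¹ = tr M` evaluated
    -- at the middle point `y + Λ`. Both outer values are expanded in the values at the middle point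
    -- and its successor.
    cayley-hamilton : ∀ x y → D x (y + Λ + Λ) + D x y ≡ trace y * D x (y + Λ)
    cayley-hamilton x y = begin
      D x c + D x y
        ≡⟨ cong₂ _+_ (expand c) (expand y) ⟩
      (D x b * D c b′ - D x b′ * D c b) + (D x b * D y b′ - D x b′ * D y b)
        ≡⟨ cong₂ (λ u v → (D x b * u - D x b′ * v) + (D x b * D y b′ - D x b′ * D y b)) e₁ e₂ ⟩
      (D x b * - D (y + 1ℤ) b - D x b′ * - D y b) + (D x b * D y b′ - D x b′ * D y b)
        ≡⟨ ring (D x b) (D x b′) (D (y + 1ℤ) b) (D y b) (D y b′) ⟩
      trace y * D x b ∎
      where
      open ≡-Reasoning
      b = y + Λ
      b′ = b + 1ℤ
      c = b + Λ
      ring : ∀ u v s t w → (u * - s - v * - t) + (u * w - v * t) ≡ (w - s) * u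
      ring = solve-∀
      e₂ : D c b ≡ - D y b
      e₂ = trans (D-anti b c) (cong -_ (D-shift y b))
      e₁ : D c b′ ≡ - D (y + 1ℤ) b
      e₁ = trans (D-anti b′ c) (cong -_ (trans (cong (λ z → D z c) (swap y Λ)) (D-shift (y + 1ℤ) b)))
        where
        swap : ∀ y l → y + l + 1ℤ ≡ y + 1ℤ + l
        swap = solve-∀
      expand : ∀ z → D x z ≡ D x b * D z b′ - D x b′ * D z b
      expand z = begin
        D x z                                ≡⟨ sym (*-identityʳ (D x z)) ⟩
        D x z * 1ℤ                           ≡⟨ cong (λ v → D x z * v) (sym (D-adj b)) ⟩
        D x z * D b b′                       ≡⟨ plücker x b z b′ ⟩
        D x b * D z b′ + D x b′ * D b z      ≡⟨ cong (λ v → D x b * D z b′ + D x b′ * v) (D-anti z b) ⟩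
        D x b * D z b′ + D x b′ * - D z b    ≡⟨ ring′ (D x b * D z b′) (D x b′) (D z b) ⟩
        D x b * D z b′ - D x b′ * D z b      ∎
        where
        ring′ : ∀ u v w → u + v * - w ≡ u - v * w
        ring′ = solve-∀

    -- Moving `y` by one applies the recurrence at both ends of the interval. The coefficients there
    -- agree by periodicity, so the products cancel in the difference.
    trace-const : ∀ x y → trace x ≡ trace y
    trace-const x y = trans (const x) (sym (const y))
      where
      shift : ∀ y → trace (y + 1ℤ) ≡ trace y
      shift y = begin
        D (y + 1ℤ) (y + 1ℤ + Λ + 1ℤ) - D (y + 1ℤ + 1ℤ) (y + 1ℤ + Λ)
          ≡⟨ cong (λ z → D (y + 1ℤ) (z + 1ℤ) - D (y + 1ℤ + 1ℤ) z) (swap y Λ) ⟩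
        D (y + 1ℤ) (b + 1ℤ + 1ℤ) - D (y + 1ℤ + 1ℤ) (b + 1ℤ)
          ≡⟨ cong₂ _-_ (next (D-solʳ (y + 1ℤ)) b) (next (D-solˡ (b + 1ℤ)) y) ⟩
        (a (b + 1ℤ) * D (y + 1ℤ) (b + 1ℤ) - D (y + 1ℤ) b) - (a (y + 1ℤ) * D (y + 1ℤ) (b + 1ℤ) - D y (b + 1ℤ))
          ≡⟨ cong (λ v → (v * D (y + 1ℤ) (b + 1ℤ) - D (y + 1ℤ) b) - (a (y + 1ℤ) * D (y + 1ℤ) (b + 1ℤ) - D y (b + 1ℤ)))
             (trans (cong a (sym (swap y Λ))) (a-periodic (y + 1ℤ))) ⟩
        (a (y + 1ℤ) * D (y + 1ℤ) (b + 1ℤ) - D (y + 1ℤ) b) - (a (y + 1ℤ) * D (y + 1ℤ) (b + 1ℤ) - D y (b + 1ℤ))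
          ≡⟨ ring (a (y + 1ℤ) * D (y + 1ℤ) (b + 1ℤ)) (D (y + 1ℤ) b) (D y (b + 1ℤ)) ⟩
        trace y ∎
        where
        open ≡-Reasoning
        b = y + Λ
        swap : ∀ y l → y + 1ℤ + l ≡ y + l + 1ℤ
        swap = solve-∀
        ring : ∀ u v w → (u - v) - (u - w) ≡ w - v
        ring = solve-∀
      const : ∀ y → trace y ≡ trace 0ℤ
      const = ℤ-induction (λ y → trace y ≡ trace 0ℤ) refl
        (λ y e → trans (shift y) e) (λ y e → trans (sym (shift y)) e)

-- Friezes and growth coefficients

-- `S k` is the trace of the `k`-th power of a matrix of determinant 1 and trace `s`, that is,
-- `2 T_k (s / 2)` with the Chebyshev polynomial `T_k` of the first kind.
module Chebyshev (s : ℤ) (S : ℕ → ℤ) (S0 : S 0 ≡ + 2) (S1 : S 1 ≡ s)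
  (rec : ∀ k → S (2 ℕ.+ k) ≡ s * S (1 ℕ.+ k) - S k) where

  constant-2 : s ≡ + 2 → ∀ k → S k ≡ + 2
  constant-2 refl zero          = S0
  constant-2 refl (suc zero)    = S1
  constant-2 refl (suc (suc k)) = trans (rec k)
    (cong₂ (λ u v → + 2 * u - v) (constant-2 refl (suc k)) (constant-2 refl k))

  increasing : + 2 < s → ∀ k → 0ℤ ≤ S k - + 2 × S k < S (suc k)
  increasing p zero = subst (λ v → 0ℤ ≤ v - + 2) (sym S0) (+≤+ ℕ.z≤n) , subst₂ _<_ (sym S0) (sym S1) p
  increasing p (suc k) with increasing p k
  ... | ge , lt = 0≤-resp (ring₁ (S k) (S (suc k))) (0≤+ ge (0≤+ (gap≥0 lt) (+≤+ (ℕ.z≤n {1})))) ,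
    -- With `u` and `v` the current values, the next gap is `(s - 3) v + (v - u - 1) + v`, a sum of
    -- nonnegative terms.
    gap≥0⇒< (subst (λ v → 0ℤ ≤ v - (1ℤ + S (suc k))) (sym (rec k))
      (0≤-resp (ring₂ s (S k) (S (suc k)))
        (0≤+ (0≤* (gap≥0 p) (0≤+ ge (0≤+ (gap≥0 lt) (+≤+ (ℕ.z≤n {3})))))
          (0≤+ (gap≥0 lt) (0≤+ ge (0≤+ (gap≥0 lt) (+≤+ (ℕ.z≤n {3}))))))))
    where
    ring₁ : ∀ u v → u - + 2 + (v - (1ℤ + u) + 1ℤ) ≡ v - + 2
    ring₁ = solve-∀
    ring₂ : ∀ s u v → (s - + 3) * (u - + 2 + (v - (1ℤ + u) + + 3)) + (v - (1ℤ + u) + (u - + 2 + (v - (1ℤ + u) + + 3))) ≡ s * v - u - (1ℤ + v)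
    ring₂ = solve-∀

  ≡2-if-once : + 2 ≤ s → ∀ k → k ℕ.> 0 → S k ≡ + 2 → ∀ k → S k ≡ + 2
  ≡2-if-once 2≤s (suc k) _ e with + 2 <? s
  ... | no ≮ = constant-2 (≤-antisym (≮⇒≥ ≮) 2≤s)
  ... | yes 2<s with increasing 2<s k
  ...   | ge , lt = ⊥-elim (<-irrefl refl (≤-<-trans (0≤i-j⇒j≤i ge) (subst (S k <_) e lt)))

module Frieze (F : InfiniteFrieze) where

  a : ℤ → ℤ
  a = quiddityRow F

  open Recurrence a public

  -- Three rows start the induction; from there on the diamond rule and Plücker's relation compute
  -- the next entry by the same division. The quiddity row has to be among the given ones because
  -- there the divisor would lie in the row of zeros.
  m≡D-gap : ∀ k i j → j ≡ i - + 2 + + k → m F i j ≡ D (i - 1ℤ) (j + 1ℤ)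
  m≡D-gap 0 i j refl = begin
    m F i (i - + 2 + 0ℤ)  ≡⟨ cong (m F i) (+-identityʳ _) ⟩
    m F i (i - + 2)       ≡⟨ zeros F i ⟩
    0ℤ                    ≡⟨ sym (D-diag (i - 1ℤ)) ⟩
    D (i - 1ℤ) (i - 1ℤ)   ≡⟨ cong (D (i - 1ℤ)) (ring i) ⟩
    D (i - 1ℤ) (i - + 2 + 0ℤ + 1ℤ) ∎
    where
    open ≡-Reasoning
    ring : ∀ i → i - 1ℤ ≡ i - + 2 + 0ℤ + 1ℤ
    ring = solve-∀
  m≡D-gap 1 i j refl = begin
    m F i (i - + 2 + 1ℤ)  ≡⟨ cong (m F i) (ring i) ⟩
    m F i (i - 1ℤ)        ≡⟨ ones F i ⟩
    1ℤ                    ≡⟨ sym (D-adj (i - 1ℤ)) ⟩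
    D (i - 1ℤ) (i - 1ℤ + 1ℤ)   ≡⟨ cong (λ z → D (i - 1ℤ) (z + 1ℤ)) (sym (ring i)) ⟩
    D (i - 1ℤ) (i - + 2 + 1ℤ + 1ℤ) ∎
    where
    open ≡-Reasoning
    ring : ∀ i → i - + 2 + 1ℤ ≡ i - 1ℤ
    ring = solve-∀
  m≡D-gap 2 i j refl = begin
    m F i (i - + 2 + + 2) ≡⟨ cong (m F i) (ring i) ⟩
    a i                   ≡⟨ sym (D-adj² i) ⟩
    D (i - 1ℤ) (i + 1ℤ)   ≡⟨ cong (λ z → D (i - 1ℤ) (z + 1ℤ)) (sym (ring i)) ⟩
    D (i - 1ℤ) (i - + 2 + + 2 + 1ℤ) ∎
    where
    open ≡-Reasoning
    ring : ∀ i → i - + 2 + + 2 ≡ i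
    ring = solve-∀
  m≡D-gap (suc (suc (suc k))) i j′ e = cancelˡ-pos {m F i′ j} (positive F i′ j i≤j)
    (begin
      m F i′ j * m F i j′         ≡⟨ *-comm (m F i′ j) (m F i j′) ⟩
      m F i j′ * m F i′ j         ≡⟨ cong (λ z → m F i z * m F i′ j) (sym (i-1+1≡i j′)) ⟩
      m F i (j + 1ℤ) * m F i′ j   ≡⟨ minus-one (m F i j * m F i′ (j + 1ℤ)) (m F i (j + 1ℤ) * m F i′ j) (diamond F i j (≤-trans (≤-reflexive (ring₀ i)) (≤-trans (shift-≤ (i - + 2) {1} {2 ℕ.+ k} (ℕ.s≤s ℕ.z≤n)) (≤-reflexive (sym e₂))))) ⟩
      m F i j * m F i′ (j + 1ℤ) - 1ℤ
        ≡⟨ cong₂ (λ u v → u * v - 1ℤ) (m≡D-gap (suc (suc k)) i j e₂) (m≡D-gap (suc (suc k)) i′ (j + 1ℤ) e₂′) ⟩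
      D x z * D y w - 1ℤ                  ≡⟨ cong (_- 1ℤ) (plücker x y z w) ⟩
      D x y * D z w + D x w * D y z - 1ℤ  ≡⟨ cong₂ (λ u v → u * v + D x w * D y z - 1ℤ) (trans (cong (D x) x+1≡y) (D-adj x)) (D-adj z) ⟩
      1ℤ * 1ℤ + D x w * D y z - 1ℤ        ≡⟨ ring₁ (D x w) (D y z) ⟩
      D y z * D x w                       ≡⟨ cong₂ (λ u t → u * D x (t + 1ℤ)) (sym (m≡D-gap (suc k) i′ j e₁)) (i-1+1≡i j′) ⟩
      m F i′ j * D x (j′ + 1ℤ)    ∎)
    where
    open ≡-Reasoning
    i′ = i + 1ℤ
    j  = j′ - 1ℤ
    x = i - 1ℤ
    y = i′ - 1ℤ
    z = j + 1ℤ
    w = j + 1ℤ + 1ℤ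
    x+1≡y : y ≡ x + 1ℤ
    x+1≡y = trans (i+1-1≡i i) (sym (i-1+1≡i i))
    ring₀ : ∀ i → i - 1ℤ ≡ i - + 2 + 1ℤ
    ring₀ = solve-∀
    ring₁ : ∀ u v → 1ℤ * 1ℤ + u * v - 1ℤ ≡ v * u
    ring₁ = solve-∀
    ring₂ : ∀ i k → i - + 2 + (+ 3 + k) - 1ℤ ≡ i - + 2 + (+ 2 + k)
    ring₂ = solve-∀
    ring₃ : ∀ i k → i - + 2 + (+ 3 + k) - 1ℤ ≡ i + 1ℤ - + 2 + (1ℤ + k)
    ring₃ = solve-∀
    ring₄ : ∀ i k → i - + 2 + (+ 3 + k) - 1ℤ + 1ℤ ≡ i + 1ℤ - + 2 + (+ 2 + k)
    ring₄ = solve-∀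
    e₂ : j ≡ i - + 2 + + (2 ℕ.+ k)
    e₂ = trans (cong (_- 1ℤ) e) (ring₂ i (+ k))
    e₁ : j ≡ i′ - + 2 + + (1 ℕ.+ k)
    e₁ = trans (cong (_- 1ℤ) e) (ring₃ i (+ k))
    e₂′ : j + 1ℤ ≡ i′ - + 2 + + (2 ℕ.+ k)
    e₂′ = trans (cong (λ z → z - 1ℤ + 1ℤ) e) (ring₄ i (+ k))
    i≤j : i′ - 1ℤ ≤ j
    i≤j = ≤-trans (≤-reflexive (ring₀ i′)) (≤-trans (shift-≤ (i′ - + 2) {1} {suc k} (ℕ.s≤s ℕ.z≤n)) (≤-reflexive (sym e₁)))
    minus-one : ∀ u v → u - v ≡ 1ℤ → v ≡ u - 1ℤ
    minus-one u v p = trans (ring u v) (cong (λ t → u - t) p)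
      where
      ring : ∀ u v → v ≡ u - (u - v)
      ring = solve-∀

  m≡D : ∀ i j → i - + 2 ≤ j → m F i j ≡ D (i - 1ℤ) (j + 1ℤ)
  m≡D i j p with ≤-gap p
  ... | k , e = m≡D-gap k i j e

  D-pos : ∀ x y → x < y → 0ℤ < D x y
  D-pos x y x<y = subst (0ℤ <_)
    (trans (m≡D (x + 1ℤ) (y - 1ℤ) (≤-trans (≤-trans (≤-reflexive (ring x)) (i-j≤i (x + 1ℤ - 1ℤ) 1ℤ)) le))
      (cong₂ D (i+1-1≡i x) (i-1+1≡i y)))
    (positive F (x + 1ℤ) (y - 1ℤ) le)
    where
    ring : ∀ x → x + 1ℤ - + 2 ≡ x + 1ℤ - 1ℤ - 1ℤ
    ring = solve-∀
    le : x + 1ℤ - 1ℤ ≤ y - 1ℤ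
    le = 0≤i-j⇒j≤i (0≤-resp (ring′ x y) (gap≥0 x<y))
      where
      ring′ : ∀ x y → y - (1ℤ + x) ≡ y - 1ℤ - (x + 1ℤ - 1ℤ)
      ring′ = solve-∀

  module _ (n : ℕ) (n-period : IsPeriod F n) where

    a-periodic : ∀ x → a (x + + n) ≡ a x
    a-periodic x = proj₂ n-period x x (i-j≤i x (+ 2))

    a-periodic* : ∀ k x → a (x + + (k ℕ.* n)) ≡ a x
    a-periodic* zero    x = cong a (+-identityʳ x)
    a-periodic* (suc k) x = trans (cong a (trans (cong (λ z → x + z) (pos-+ n (k ℕ.* n)))
      (sym (+-assoc x (+ n) (+ (k ℕ.* n)))))) (trans (a-periodic* k (x + + n)) (a-periodic x))

    growth-D : ∀ k → growth F n k ≡ D 0ℤ (+ (k ℕ.* n) + 1ℤ) - D 1ℤ (+ (k ℕ.* n))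
    growth-D zero = sym (cong₂ _-_ (D-adj 0ℤ) (trans (D-anti 0ℤ 1ℤ) (cong -_ (D-adj 0ℤ))))
    growth-D k@(suc _) = cong₂ _-_ (m≡D 1ℤ L (≤-trans -≤+ (+≤+ ℕ.z≤n)))
      (trans (m≡D (+ 2) (L - 1ℤ) (i≤j⇒0≤j-i′)) (cong (D 1ℤ) (i-1+1≡i L)))
      where
      L = + (k ℕ.* n)
      i≤j⇒0≤j-i′ : 0ℤ ≤ L - 1ℤ
      i≤j⇒0≤j-i′ = i≤j⇒0≤j-i (+≤+ (ℕ.*-mono-≤ {1} {k} {1} {n} (ℕ.s≤s ℕ.z≤n) (proj₁ n-period)))

    growth≡trace : ∀ k x → growth F n (suc k) ≡ Periodic.trace (suc k ℕ.* n) (a-periodic* (suc k)) x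
    growth≡trace k x = trans (growth-D (suc k)) (Periodic.trace-const (suc k ℕ.* n) (a-periodic* (suc k)) 0ℤ x)

    open Periodic n a-periodic

    s : ℤ
    s = trace 0ℤ

    CH : ∀ x y → D x (y + Λ + Λ) + D x y ≡ s * D x (y + Λ)
    CH x y = trans (cayley-hamilton x y) (cong (_* D x (y + Λ)) (trace-const y 0ℤ))

    growth-1 : growth F n 1 ≡ s
    growth-1 = trans (growth-D 1) (cong (λ z → D 0ℤ (+ z + 1ℤ) - D 1ℤ (+ z)) (ℕ.+-identityʳ n))

    growth-rec : ∀ k → growth F n (2 ℕ.+ k) ≡ s * growth F n (1 ℕ.+ k) - growth F n k
    growth-rec k = begin
      growth F n (2 ℕ.+ k)                                                 ≡⟨ growth-D (2 ℕ.+ k) ⟩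
      D 0ℤ (+ ((2 ℕ.+ k) ℕ.* n) + 1ℤ) - D 1ℤ (+ ((2 ℕ.+ k) ℕ.* n))         ≡⟨ cong (λ z → D 0ℤ (z + 1ℤ) - D 1ℤ z) i₂ ⟩
      D 0ℤ (y + Λ + Λ + 1ℤ) - D 1ℤ (y + Λ + Λ)                             ≡⟨ cong (λ z → D 0ℤ z - D 1ℤ (y + Λ + Λ)) (swap₂ y Λ) ⟩
      D 0ℤ (y + 1ℤ + Λ + Λ) - D 1ℤ (y + Λ + Λ)                             ≡⟨ cong₂ _-_ (solve-for (D 0ℤ (y + 1ℤ + Λ + Λ)) (D 0ℤ (y + 1ℤ)) (CH 0ℤ (y + 1ℤ))) (solve-for (D 1ℤ (y + Λ + Λ)) (D 1ℤ y) (CH 1ℤ y)) ⟩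
      (s * D 0ℤ (y + 1ℤ + Λ) - D 0ℤ (y + 1ℤ)) - (s * D 1ℤ (y + Λ) - D 1ℤ y) ≡⟨ cong (λ z → (s * D 0ℤ z - D 0ℤ (y + 1ℤ)) - (s * D 1ℤ (y + Λ) - D 1ℤ y)) (swap y Λ) ⟩
      (s * D 0ℤ (y + Λ + 1ℤ) - D 0ℤ (y + 1ℤ)) - (s * D 1ℤ (y + Λ) - D 1ℤ y) ≡⟨ ring s (D 0ℤ (y + Λ + 1ℤ)) (D 0ℤ (y + 1ℤ)) (D 1ℤ (y + Λ)) (D 1ℤ y) ⟩
      s * (D 0ℤ (y + Λ + 1ℤ) - D 1ℤ (y + Λ)) - (D 0ℤ (y + 1ℤ) - D 1ℤ y)     ≡⟨ cong₂ (λ u v → s * u - v) (sym (trans (growth-D (1 ℕ.+ k)) (cong (λ z → D 0ℤ (z + 1ℤ) - D 1ℤ z) (i₁ k)))) (sym (growth-D k)) ⟩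
      s * growth F n (1 ℕ.+ k) - growth F n k ∎
      where
      open ≡-Reasoning
      y = + (k ℕ.* n)
      i₁ : ∀ k → + (suc k ℕ.* n) ≡ + (k ℕ.* n) + Λ
      i₁ k = trans (pos-+ n (k ℕ.* n)) (+-comm (+ n) (+ (k ℕ.* n)))
      i₂ : + ((2 ℕ.+ k) ℕ.* n) ≡ y + Λ + Λ
      i₂ = trans (i₁ (suc k)) (cong (_+ Λ) (i₁ k))
      swap : ∀ y l → y + 1ℤ + l ≡ y + l + 1ℤ
      swap = solve-∀
      swap₂ : ∀ y l → y + l + l + 1ℤ ≡ y + 1ℤ + l + l
      swap₂ = solve-∀
      solve-for : ∀ u v {w} → u + v ≡ w → u ≡ w - v
      solve-for u v refl = ring u v
        where
        ring : ∀ u v → u ≡ u + v - v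
        ring = solve-∀
      ring : ∀ s a b c d → (s * a - b) - (s * c - d) ≡ s * (a - c) - (b - d)
      ring = solve-∀

    -- s ≤ 1 would give u₂ ≤ u₁ - u₀ and hence u₃ ≤ u₂ - u₁ ≤ - u₀ < 0.
    2≤s : + 2 ≤ s
    2≤s = ≮⇒≥ λ s<2 → 0≰-1 (0≤-resp (ring s u₀ u₁ u₂ u₃ (CH 0ℤ 1ℤ) (CH 0ℤ (1ℤ + Λ)))
      (0≤+ (0≤* (gap≥0 s<2) (0≤+ (<⇒≤ u₁>0) (<⇒≤ u₂>0))) (0≤+ (<⇒≤ u₃>0) (gap≥0 u₀>0))))
      where
      u₀ = D 0ℤ 1ℤ
      u₁ = D 0ℤ (1ℤ + Λ)
      u₂ = D 0ℤ (1ℤ + Λ + Λ)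
      u₃ = D 0ℤ (1ℤ + Λ + Λ + Λ)
      u₀>0 : 0ℤ < u₀
      u₀>0 = D-pos 0ℤ 1ℤ (+<+ (ℕ.s≤s ℕ.z≤n))
      u₁>0 : 0ℤ < u₁
      u₁>0 = D-pos 0ℤ (1ℤ + Λ) (+<+ (ℕ.s≤s ℕ.z≤n))
      u₂>0 : 0ℤ < u₂
      u₂>0 = D-pos 0ℤ (1ℤ + Λ + Λ) (+<+ (ℕ.s≤s ℕ.z≤n))
      u₃>0 : 0ℤ < u₃
      u₃>0 = D-pos 0ℤ (1ℤ + Λ + Λ + Λ) (+<+ (ℕ.s≤s ℕ.z≤n))
      ring : ∀ s u₀ u₁ u₂ u₃ → u₂ + u₀ ≡ s * u₁ → u₃ + u₁ ≡ s * u₂ →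
        (+ 2 - (1ℤ + s)) * (u₁ + u₂) + (u₃ + (u₀ - (1ℤ + 0ℤ))) ≡ -1ℤ
      ring s u₀ u₁ u₂ u₃ e e′ = trans (lem s u₀ u₁ u₂ u₃)
        (trans (cong₂ (λ v w → (v - s * u₁) + (w - s * u₂) - 1ℤ) e e′) (lem′ s u₁ u₂))
        where
        lem : ∀ s u₀ u₁ u₂ u₃ → (+ 2 - (1ℤ + s)) * (u₁ + u₂) + (u₃ + (u₀ - (1ℤ + 0ℤ)))
            ≡ (u₂ + u₀ - s * u₁) + (u₃ + u₁ - s * u₂) - 1ℤ
        lem = solve-∀
        lem′ : ∀ s u₁ u₂ → (s * u₁ - s * u₁) + (s * u₂ - s * u₂) - 1ℤ ≡ -1ℤ
        lem′ = solve-∀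

    open Chebyshev s (growth F n) refl growth-1 growth-rec public

    growth-2-if-once : ∀ k → k ℕ.> 0 → growth F n k ≡ + 2 → ∀ k → growth F n k ≡ + 2
    growth-2-if-once = ≡2-if-once 2≤s

-- Periodic triangulations of the half-plane

-- The meeting point of the two directions. Boundary segments count as chords, which gives every fan
-- a first edge, and lengths stop at `N` because a longer curve crosses its own translate.
record PeriodicTriangulation (N : ℕ) (a : ℤ → ℤ) : Set₁ where
  field
    Chord         : ℤ → ℤ → Set
    Ray           : ℤ → Set
    chord?        : ∀ x y → Dec (Chord x y)
    ray?          : ∀ x → Dec (Ray x)
    chord-<       : ∀ {x y} → Chord x y → x < y
    chord-≤       : ∀ {x y} → Chord x y → y ≤ x + + N
    boundary      : ∀ x → Chord x (x + 1ℤ)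
    chord-shift   : ∀ {x y} → Chord x y → Chord (x + + N) (y + + N)
    chord-unshift : ∀ {x y} → Chord (x + + N) (y + + N) → Chord x y
    ray-shift     : ∀ {x} → Ray x → Ray (x + + N)
    ray-unshift   : ∀ {x} → Ray (x + + N) → Ray x
    chord-chord   : ∀ {x y u v} → Chord x y → Chord u v → x < u → u < y → y < v → ⊥
    chord-ray     : ∀ {x y z} → Chord x y → Ray z → x < z → z < y → ⊥
    chord-maximal : ∀ x y → x < y → y ≤ x + + N →
                    (∀ {u v} → Chord u v → x < u → u < y → y < v → ⊥) →
                    (∀ {u v} → Chord u v → u < x → x < v → v < y → ⊥) →
                    (∀ {z} → Ray z → x < z → z < y → ⊥) → Chord x y
    ray-maximal   : ∀ x → (∀ {u v} → Chord u v → u < x → x < v → ⊥) → Ray x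

  rightDegree : ℤ → ℕ → ℤ
  rightDegree x = sumTo λ d → 𝟙 (chord? x (x + + d))

  leftDegree : ℤ → ℕ → ℤ
  leftDegree x = sumTo λ d → 𝟙 (chord? (x - + d) x)

  field
    -- One more than the number of ends of arcs. Each of the two sums also counts a boundary
    -- segment, and `1 - 2` leaves `- 1ℤ`.
    degree : ∀ x → a x ≡ rightDegree x N + leftDegree x N - 1ℤ + 𝟙 (ray? x)

sumTo-last : ∀ g {j k} → j ℕ.< k → g k ≡ 1ℤ → (∀ d → j ℕ.< d → d ℕ.< k → g d ≡ 0ℤ) →
  sumTo g k ≡ sumTo g j + 1ℤ
sumTo-last g {j} {suc k} j<k one zeros =
  cong₂ _+_ (sumTo-tail g (ℕ.≤-pred j<k) λ d j<d d≤k → zeros d j<d (ℕ.s≤s d≤k)) one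

x≡x+k-k : ∀ x k → x ≡ x + k - k
x≡x+k-k = solve-∀

shift-back-< : ∀ x {d e} → d ℕ.< e → x - + e < x - + d
shift-back-< x d<e = +-monoʳ-< x (neg-mono-< (+<+ d<e))

module Telescoping {N : ℕ} {a : ℤ → ℤ} (P : PeriodicTriangulation N a) where

  open PeriodicTriangulation P
  open Recurrence a using (Solution)

  N≥1 : 1 ℕ.≤ N
  N≥1 = drop‿+≤+ (subst (1ℤ ≤_) (+-identityˡ (+ N)) (chord-≤ (boundary 0ℤ)))

  -- No chord passes over the start of a longest chord.
  some-ray : ¬ (∀ x → ¬ Ray x)
  some-ray none = descend (suc N) λ {x} c l → <-irrefl refl
    (<-≤-trans (shift-< x ℕ.≤-refl) (≤-trans l (chord-≤ c)))
    where
    descend : ∀ k → (∀ {x y} → Chord x y → x + + k ≤ y → ⊥) → ⊥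
    descend zero    short = short (boundary 0ℤ) (+≤+ ℕ.z≤n)
    descend (suc k) short = descend k λ {x} {y} c l → none x (ray-maximal x λ {u} {v} d u<x x<v →
      outer c l d u<x x<v (<-≤-connex v y))
      where
      lengthen : ∀ u x → u < x → u + + suc k ≤ x + + k
      lengthen u x u<x = 0≤i-j⇒j≤i (0≤-resp (ring u x (+ k)) (gap≥0 u<x))
        where
        ring : ∀ u x k → x - (1ℤ + u) ≡ x + k - (u + (1ℤ + k))
        ring = solve-∀
      outer : ∀ {x y u v} → Chord x y → x + + k ≤ y → Chord u v → u < x → x < v → v < y ⊎ y ≤ v → ⊥
      outer c l d u<x x<v (inj₁ v<y) = chord-chord d c u<x x<v v<y
      outer {x} {y} {u} c l d u<x x<v (inj₂ y≤v) = short d (≤-trans (lengthen u x u<x) (≤-trans l y≤v))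

  module _ {f : ℤ → ℤ} (sol : Solution f) where

    -- The telescoped recurrence below a chord, read from both of its ends: with `r` chords from `x`
    -- up to and including the one to `y` there are `r - 1` triangles at `x`, and each contributes
    -- one `f x`.
    Fan : ℤ → ℤ → ℕ → Set
    Fan x y k = f (x + 1ℤ) ≡ (rightDegree x k - 1ℤ) * f x + f y
              × f (y - 1ℤ) ≡ (leftDegree y k - 1ℤ) * f y + f x

    rightDegree-cut : ∀ {x k} → k ℕ.≤ N → (∀ d → k ℕ.< d → Chord x (x + + d) → ⊥) → rightDegree x N ≡ rightDegree x k
    rightDegree-cut {x} k≤N none = sumTo-tail _ k≤N λ d k<d _ → 𝟙-no (chord? x (x + + d)) (none d k<d)

    leftDegree-cut : ∀ {x k} → k ℕ.≤ N → (∀ d → k ℕ.< d → Chord (x - + d) x → ⊥) → leftDegree x N ≡ leftDegree x k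
    leftDegree-cut {x} k≤N none = sumTo-tail _ k≤N λ d k<d _ → 𝟙-no (chord? (x - + d) x) (none d k<d)

    -- The apex z of the triangle below (x , y) is the last one before y with a
    -- chord (x , z); the recurrence at z becomes f z ≡ f x + f y.
    polygon : ∀ b k → k ℕ.≤ b → ∀ x y → y ≡ x + + k → Chord x y → Fan x y k
    polygon b zero _ x y refl c = ⊥-elim (<-irrefl (sym (+-identityʳ x)) (chord-< c))
    polygon b (suc zero) _ x y refl c
      rewrite 𝟙-yes (chord? x (x + 1ℤ)) c | i+1-1≡i x | 𝟙-yes (chord? x (x + 1ℤ)) c =
        ring (f x) (f (x + 1ℤ)) , ring (f (x + 1ℤ)) (f x)
      where
      ring : ∀ u v → v ≡ (0ℤ + 1ℤ - 1ℤ) * u + v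
      ring = solve-∀
    polygon (suc b) k@(suc (suc _)) k≤b x y y≡ c
      with lastBelow (λ j → chord? x (x + + j)) k (boundary x) (ℕ.s≤s (ℕ.s≤s ℕ.z≤n))
    ... | j , 1≤j , j<k , cz , none = fan
      where
      z = x + + j
      k′ = k ℕ.∸ j
      j+k′≡k : j ℕ.+ k′ ≡ k
      j+k′≡k = ℕ.m+[n∸m]≡n (ℕ.<⇒≤ j<k)
      y≡z+k′ : y ≡ z + + k′
      y≡z+k′ = trans y≡ (trans (cong (λ i → x + + i) (sym j+k′≡k)) (sym (+-assoc x (+ j) (+ k′))))
      z≡y-k′ : z ≡ y - + k′
      z≡y-k′ = trans (x≡x+k-k z (+ k′)) (cong (_- + k′) (sym y≡z+k′))
      x≡z-j : x ≡ z - + j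
      x≡z-j = x≡x+k-k x (+ j)
      x≡y-k : x ≡ y - + k
      x≡y-k = trans (x≡x+k-k x (+ k)) (cong (_- + k) (sym y≡))
      x<z : x < z
      x<z = chord-< cz
      z<y : z < y
      z<y = subst (z <_) (sym y≡) (shift-< x j<k)
      -- By maximality: an obstacle would cross the chord from `x` to `y` or the one from `x` to
      -- `z`, or it would start at `x` and end between `z` and `y`, against the choice of `z`.
      cy : Chord z y
      cy = chord-maximal z y z<y (≤-trans (chord-≤ c) (+-monoˡ-≤ (+ N) (<⇒≤ x<z)))
        (λ d z<u u<y y<v → chord-chord c d (<-trans x<z z<u) u<y y<v)
        (λ {u} {v} d u<z z<v v<y → left d u<z z<v v<y (<-cmp x u))
        (λ r z<w w<y → chord-ray c r (<-trans x<z z<w) w<y)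
        where
        left : ∀ {u v} → Chord u v → u < z → z < v → v < y → _ → ⊥
        left d u<z z<v v<y (tri< x<u _ _) = chord-chord cz d x<u u<z z<v
        left {u} {v} d u<z z<v v<y (tri≈ _ refl _) with <-gap (chord-< d)
        ... | i , refl = none (suc i) (unshift-< x z<v) (unshift-< x (subst (x + + suc i <_) y≡ v<y)) d
        left d u<z z<v v<y (tri> _ _ u<x) = chord-chord d c u<x (<-trans x<z z<v) v<y
      k≤N : k ℕ.≤ N
      k≤N = ℕ.≮⇒≥ λ N<k → <-irrefl refl (<-≤-trans (shift-< x N<k) (subst (_≤ x + + N) y≡ (chord-≤ c)))
      k′<k : k′ ℕ.< k
      k′<k = subst (k′ ℕ.<_) j+k′≡k (ℕ.m<n+m k′ 1≤j)
      ihˡ : Fan x z j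
      ihˡ = polygon b j (ℕ.≤-pred (ℕ.≤-trans j<k k≤b)) x z refl cz
      ihʳ : Fan z y k′
      ihʳ = polygon b k′ (ℕ.≤-pred (ℕ.≤-trans k′<k k≤b)) z y y≡z+k′ cy
      right-x : rightDegree x k ≡ rightDegree x j + 1ℤ
      right-x = sumTo-last _ j<k (𝟙-yes (chord? x (x + + k)) (subst (Chord x) y≡ c))
        λ d j<d d<k → 𝟙-no (chord? x (x + + d)) (none d j<d d<k)
      left-y : leftDegree y k ≡ leftDegree y k′ + 1ℤ
      left-y = sumTo-last _ k′<k (𝟙-yes (chord? (y - + k) y) (subst (λ w → Chord w y) x≡y-k c))
        λ d k′<d d<k → 𝟙-no (chord? (y - + d) y) λ e → chord-chord cz e
          (subst (_< y - + d) (sym x≡y-k) (shift-back-< y d<k)) (subst (y - + d <_) (sym z≡y-k′) (shift-back-< y k′<d)) z<y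
      right-z : rightDegree z N ≡ rightDegree z k′
      right-z = rightDegree-cut (ℕ.≤-trans (ℕ.<⇒≤ k′<k) k≤N) λ d k′<d e →
        chord-chord c e x<z z<y (subst (_< z + + d) (sym y≡z+k′) (shift-< z k′<d))
      left-z : leftDegree z N ≡ leftDegree z j
      left-z = leftDegree-cut (ℕ.≤-trans (ℕ.<⇒≤ j<k) k≤N) λ d j<d e →
        chord-chord e c (subst (z - + d <_) (sym x≡z-j) (shift-back-< z j<d)) x<z z<y
      a-z : a z ≡ rightDegree z k′ + leftDegree z j - 1ℤ + 0ℤ
      a-z = trans (degree z) (cong₂ _+_ (cong₂ (λ u v → u + v - 1ℤ) right-z left-z)
        (𝟙-no (ray? z) λ r → chord-ray c r x<z z<y))
      f-z : f z ≡ f x + f y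
      f-z = ring (leftDegree z j) (rightDegree z k′) (f x) (f y) (f z)
        (trans (sym (cong₂ _+_ (proj₂ ihˡ) (proj₁ ihʳ))) (trans (sol z) (cong (_* f z) a-z)))
        where
        ring : ∀ l r u v w → ((l - 1ℤ) * w + u) + ((r - 1ℤ) * w + v) ≡ (r + l - 1ℤ + 0ℤ) * w → w ≡ u + v
        ring l r u v w e = trans (lem l r w) (trans (cong (λ t → t - (r + l - + 2) * w) (sym e)) (lem′ l r u v w))
          where
          lem : ∀ l r w → w ≡ (r + l - 1ℤ + 0ℤ) * w - (r + l - + 2) * w
          lem = solve-∀
          lem′ : ∀ l r u v w → ((l - 1ℤ) * w + u) + ((r - 1ℤ) * w + v) - (r + l - + 2) * w ≡ u + v
          lem′ = solve-∀
      fan : Fan x y k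
      fan = trans (proj₁ ihˡ) (trans (cong (λ t → (rightDegree x j - 1ℤ) * f x + t) f-z)
              (trans (ring (rightDegree x j) (f x) (f y)) (cong (λ t → (t - 1ℤ) * f x + f y) (sym right-x))))
          , trans (proj₂ ihʳ) (trans (cong (λ t → (leftDegree y k′ - 1ℤ) * f y + t) (trans f-z (+-comm (f x) (f y))))
              (trans (ring (leftDegree y k′) (f y) (f x)) (cong (λ t → (t - 1ℤ) * f y + f x) (sym left-y))))
        where
        ring : ∀ r u v → (r - 1ℤ) * u + (u + v) ≡ (r + 1ℤ - 1ℤ) * u + v
        ring = solve-∀

    -- At a ray this is the increment of `f` up to the next ray, written without reference to that
    -- ray; hence it can be computed both from the right and from the left and compared.
    slope : ℤ → ℤ
    slope x = f (x + 1ℤ) - rightDegree x N * f x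

    -- Neighbouring rays are joined by a chord, a loop if there is one ray per turn. Its fan at `x`
    -- gives the slope at `x` directly, its fan at `y` gives the slope at `y` through the
    -- recurrence.
    consecutive-rays : ∀ x y k → y ≡ x + + suc k → suc k ℕ.≤ N → Ray x → Ray y →
      (∀ {z} → Ray z → x < z → z < y → ⊥) → slope y ≡ slope x × f y - f x ≡ slope x
    consecutive-rays x y k′ y≡ k≤N rx ry none = trans slope-y (sym slope-x) , sym slope-x
      where
      k = suc k′
      x<y : x < y
      x<y = subst (x <_) (sym y≡) (x<x+suc x k′)
      x≡y-k : x ≡ y - + k
      x≡y-k = trans (x≡x+k-k x (+ k)) (cong (_- + k) (sym y≡))
      c : Chord x y
      c = chord-maximal x y x<y (subst (_≤ x + + N) (sym y≡) (shift-≤ x k≤N))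
        (λ d x<u u<y y<v → chord-ray d ry u<y y<v)
        (λ d u<x x<v v<y → chord-ray d rx u<x x<v)
        none
      fan : Fan x y k
      fan = polygon k k ℕ.≤-refl x y y≡ c
      right-x : rightDegree x N ≡ rightDegree x k
      right-x = rightDegree-cut k≤N λ d k<d e → chord-ray e ry x<y (subst (_< x + + d) (sym y≡) (shift-< x k<d))
      left-y : leftDegree y N ≡ leftDegree y k
      left-y = leftDegree-cut k≤N λ d k<d e → chord-ray e rx (subst (y - + d <_) (sym x≡y-k) (shift-back-< y k<d)) x<y
      slope-x : slope x ≡ f y - f x
      slope-x = trans (cong₂ (λ u v → u - v * f x) (proj₁ fan) right-x) (ring (rightDegree x k) (f x) (f y))
        where
        ring : ∀ r u v → (r - 1ℤ) * u + v - r * u ≡ v - u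
        ring = solve-∀
      a-y : a y ≡ rightDegree y N + leftDegree y k - 1ℤ + 1ℤ
      a-y = trans (degree y) (cong₂ (λ u v → rightDegree y N + u - 1ℤ + v) left-y (𝟙-yes (ray? y) ry))
      slope-y : slope y ≡ f y - f x
      slope-y = ring (leftDegree y k) (rightDegree y N) (f x) (f y) (f (y + 1ℤ))
        (trans (cong (_+ f (y + 1ℤ)) (sym (proj₂ fan))) (trans (sol y) (cong (_* f y) a-y)))
        where
        ring : ∀ l r u v w → ((l - 1ℤ) * v + u) + w ≡ (r + l - 1ℤ + 1ℤ) * v → w - r * v ≡ v - u
        ring l r u v w e = trans (lem l r u v w) (trans (cong (λ t → t - ((l - 1ℤ) * v + u) - r * v) e) (lem′ l r u v))
          where
          lem : ∀ l r u v w → w - r * v ≡ ((l - 1ℤ) * v + u) + w - ((l - 1ℤ) * v + u) - r * v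
          lem = solve-∀
          lem′ : ∀ l r u v → (r + l - 1ℤ + 1ℤ) * v - ((l - 1ℤ) * v + u) - r * v ≡ v - u
          lem′ = solve-∀

    rays : ℤ → ℕ → ℤ
    rays x = sumTo λ d → 𝟙 (ray? (x + + d))

    along-rays : ∀ b k → k ℕ.≤ b → ∀ x → Ray x → Ray (x + + k) →
      slope (x + + k) ≡ slope x × f (x + + k) - f x ≡ rays x k * slope x
    along-rays b zero _ x rx _ rewrite +-identityʳ x = refl , trans (+-inverseʳ (f x)) (sym (*-zeroˡ (slope x)))
    along-rays (suc b) k@(suc _) k≤b x rx ry
      with lastBelow (λ j → ray? (x + + j)) k (subst Ray (sym (+-identityʳ x)) rx) (ℕ.s≤s ℕ.z≤n)
    ... | j , _ , j<k , rz , none = trans (proj₁ st) (proj₁ ih) ,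
      trans (ring (f x) (f z) (f y)) (trans (cong₂ _+_ (trans (proj₂ st) (proj₁ ih)) (proj₂ ih))
       (trans (ring′ (slope x) (rays x j)) (cong (_* slope x) (sym count))))
      where
      z = x + + j
      y = x + + k
      k′ = k ℕ.∸ suc j
      j+k′≡k : j ℕ.+ suc k′ ≡ k
      j+k′≡k = trans (ℕ.+-suc j k′) (ℕ.m+[n∸m]≡n j<k)
      y≡z+k′ : y ≡ z + + suc k′
      y≡z+k′ = trans (cong (λ i → x + + i) (sym j+k′≡k)) (sym (+-assoc x (+ j) (+ suc k′)))
      -- The translate of the ray at `z` by one turn is a ray too, and none lies strictly between
      -- `z` and `y`.
      k′≤N : suc k′ ℕ.≤ N
      k′≤N = ℕ.≮⇒≥ λ N<k′ → none (j ℕ.+ N) (ℕ.m<m+n j N≥1)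
        (subst (j ℕ.+ N ℕ.<_) j+k′≡k (ℕ.+-monoʳ-< j N<k′))
        (subst Ray (+-assoc x (+ j) (+ N)) (ray-shift rz))
      between : ∀ {w} → Ray w → z < w → w < y → ⊥
      between r z<w w<y with <-gap z<w
      ... | i , refl = none (j ℕ.+ suc i) (ℕ.m<m+n j (ℕ.s≤s ℕ.z≤n))
            (unshift-< x (subst (_< y) (+-assoc x (+ j) (+ suc i)) w<y))
            (subst Ray (+-assoc x (+ j) (+ suc i)) r)
      ih = along-rays b j (ℕ.≤-pred (ℕ.≤-trans j<k k≤b)) x rx rz
      st = consecutive-rays z y k′ y≡z+k′ k′≤N rz ry between
      count : rays x k ≡ rays x j + 1ℤ
      count = sumTo-last _ j<k (𝟙-yes (ray? y) ry) λ d j<d d<k → 𝟙-no (ray? (x + + d)) (none d j<d d<k)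
      ring : ∀ u v w → w - u ≡ (w - v) + (v - u)
      ring = solve-∀
      ring′ : ∀ s r → s + r * s ≡ (r + 1ℤ) * s
      ring′ = solve-∀

    ray-shift* : ∀ k x → (Ray x → Ray (x + + (k ℕ.* N))) × (Ray (x + + (k ℕ.* N)) → Ray x)
    ray-shift* zero    x rewrite +-identityʳ x = (λ r → r) , (λ r → r)
    ray-shift* (suc k) x = (λ r → subst Ray eq (proj₁ (ray-shift* k (x + + N)) (ray-shift r)))
      , (λ r → ray-unshift (proj₂ (ray-shift* k (x + + N)) (subst Ray (sym eq) r)))
      where
      eq : x + + N + + (k ℕ.* N) ≡ x + + (suc k ℕ.* N)
      eq = trans (+-assoc x (+ N) (+ (k ℕ.* N))) (cong (λ z → x + z) (sym (pos-+ N (k ℕ.* N))))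

    -- Two successive stretches of `k` turns contain equally many rays, and the slope is the same at
    -- the start of both.
    arithmetic-progression : ∀ k x → Ray x → let L = + (k ℕ.* N) in
      f (x + L + L) - f (x + L) ≡ f (x + L) - f x
    arithmetic-progression k x r = trans (proj₂ second) (trans (cong₂ _*_ same-rays (proj₁ first)) (sym (proj₂ first)))
      where
      l = k ℕ.* N
      L = + l
      r′ = proj₁ (ray-shift* k x) r
      first  = along-rays l l ℕ.≤-refl x r r′
      second = along-rays l l ℕ.≤-refl (x + L) r′ (proj₁ (ray-shift* k (x + L)) r′)
      swap : ∀ x l d → x + l + d ≡ x + d + l
      swap = solve-∀
      same-rays : rays (x + L) l ≡ rays x l
      same-rays = sumTo-cong l λ d _ _ → 𝟙-cong (ray? (x + L + + d)) (ray? (x + + d))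
        (λ q → proj₂ (ray-shift* k (x + + d)) (subst Ray (swap x L (+ d)) q))
        (λ q → subst Ray (sym (swap x L (+ d))) (proj₁ (ray-shift* k (x + + d)) q))

-- Arcs and their lifts

_≟ᶜ_ : ∀ {N} → DecidableEquality (Curve N)
bridging i     ≟ᶜ bridging j     = map′ (cong bridging) (λ { refl → refl }) (i Fin.≟ j)
bridging i     ≟ᶜ peripheral j e = no λ ()
peripheral i d ≟ᶜ bridging j     = no λ ()
peripheral i d ≟ᶜ peripheral j e = map′ (λ { (refl , refl) → refl }) (λ { refl → refl , refl })
  ((i Fin.≟ j) ×-dec (d ℕ.≟ e))

_∈?_ : ∀ {N} (c : Curve N) cs → Dec (c ∈ cs)
_∈?_ = DecMembership._∈?_ _≟ᶜ_

translate : ℤ → Lifted → Lifted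
translate w (ray x)     = ray (x + w)
translate w (chord x y) = chord (x + w) (y + w)

LiftsCross-translate : ∀ w A B → LiftsCross A B → LiftsCross (translate w A) (translate w B)
LiftsCross-translate w (ray x)     (chord u v) (p , q) = +-monoˡ-< w p , +-monoˡ-< w q
LiftsCross-translate w (chord u v) (ray x)     (p , q) = +-monoˡ-< w p , +-monoˡ-< w q
LiftsCross-translate w (chord u v) (chord x y) (inj₁ (p , q , r)) =
  inj₁ (+-monoˡ-< w p , +-monoˡ-< w q , +-monoˡ-< w r)
LiftsCross-translate w (chord u v) (chord x y) (inj₂ (p , q , r)) =
  inj₂ (+-monoˡ-< w p , +-monoˡ-< w q , +-monoˡ-< w r)

module MarkedPoints (N : ℕ) .{{nz : NonZero N}} where

  residue : ℤ → Fin N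
  residue x = fromℕ< (n%ℕd<d x N)

  turns : ℤ → ℤ
  turns x = x /ℕ N

  point : Fin N → ℤ → ℤ
  point i t = + toℕ i + t * + N

  point-residue : ∀ x → point (residue x) (turns x) ≡ x
  point-residue x = sym (trans (a≡a%ℕn+[a/ℕn]*n x N)
    (cong (λ r → + r + turns x * + N) (sym (Fin.toℕ-fromℕ< (n%ℕd<d x N)))))

  point-≮ : ∀ i j {s t} → point i s ≡ point j t → ¬ s < t
  point-≮ i j {s} {t} e s<t = 0≰-1 (0≤-resp (ring (+ toℕ i) (+ toℕ j) s t (+ N) e)
    (0≤+ (gap≥0 (+<+ (Fin.toℕ<n i))) (0≤+ (+≤+ (ℕ.z≤n {toℕ j})) (0≤* (gap≥0 s<t) (+≤+ (ℕ.z≤n {N}))))))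
    where
    ring : ∀ i j s t n → i + s * n ≡ j + t * n → n - (1ℤ + i) + (j + (t - (1ℤ + s)) * n) ≡ -1ℤ
    ring i j s t n e = trans (lem i j s t n) (trans (cong (λ v → j + t * n - v - 1ℤ) e) (lem′ j t n))
      where
      lem : ∀ i j s t n → n - (1ℤ + i) + (j + (t - (1ℤ + s)) * n) ≡ j + t * n - (i + s * n) - 1ℤ
      lem = solve-∀
      lem′ : ∀ j t n → j + t * n - (j + t * n) - 1ℤ ≡ -1ℤ
      lem′ = solve-∀

  point-injective : ∀ i j s t → point i s ≡ point j t → i ≡ j × s ≡ t
  point-injective i j s t e with <-cmp s t
  ... | tri< s<t _ _ = ⊥-elim (point-≮ i j e s<t)
  ... | tri> _ _ t<s = ⊥-elim (point-≮ j i (sym e) t<s)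
  ... | tri≈ _ refl _ = Fin.toℕ-injective (+-injective (cancel (+ toℕ i) (+ toℕ j) (s * + N) e)) , refl
    where
    cancel : ∀ u v w → u + w ≡ v + w → u ≡ v
    cancel u v w e = trans (lem u w) (trans (cong (_- w) e) (sym (lem v w)))
      where
      lem : ∀ u w → u ≡ u + w - w
      lem = solve-∀

  residue-point : ∀ i t → residue (point i t) ≡ i
  residue-point i t = proj₁ (point-injective (residue (point i t)) i (turns (point i t)) t (point-residue (point i t)))

  residue-unique : ∀ x i t → x ≡ point i t → residue x ≡ i
  residue-unique x i t refl = residue-point i t

  residue-shift : ∀ x t → residue (x + t * + N) ≡ residue x
  residue-shift x t = residue-unique _ (residue x) (turns x + t)
    (trans (cong (_+ t * + N) (sym (point-residue x))) (ring (+ toℕ (residue x)) (turns x) t (+ N)))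
    where
    ring : ∀ i s t n → i + s * n + t * n ≡ i + (s + t) * n
    ring = solve-∀

  residue-period : ∀ x → residue (x + + N) ≡ residue x
  residue-period x = trans (cong (λ z → residue (x + z)) (sym (*-identityˡ (+ N)))) (residue-shift x 1ℤ)

  lift-bridging : ∀ x → lift (turns x) (bridging (residue x)) ≡ ray x
  lift-bridging x = cong ray (point-residue x)

  lift-peripheral : ∀ x d → lift (turns x) (peripheral (residue x) d) ≡ chord x (x + + d)
  lift-peripheral x d = cong (λ z → chord z (z + + d)) (point-residue x)

  lift-translate : ∀ t w (c : Curve N) → translate (w * + N) (lift t c) ≡ lift (t + w) c
  lift-translate t w (bridging i) = cong ray (ring (+ toℕ i) t w (+ N))
    where
    ring : ∀ i t w n → i + t * n + w * n ≡ i + (t + w) * n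
    ring = solve-∀
  lift-translate t w (peripheral i d) = cong₂ chord (ring (+ toℕ i) t w (+ N)) (ring′ (+ toℕ i) t w (+ N) (+ d))
    where
    ring : ∀ i t w n → i + t * n + w * n ≡ i + (t + w) * n
    ring = solve-∀
    ring′ : ∀ i t w n d → i + t * n + d + w * n ≡ i + (t + w) * n + d
    ring′ = solve-∀

  -- Deck transformations preserve crossings, so the lift of the first curve can be prescribed.
  LiftsCross-align : ∀ s s′ t (a b : Curve N) → LiftsCross (lift s a) (lift t b) →
    LiftsCross (lift s′ a) (lift (t + (s′ - s)) b)
  LiftsCross-align s s′ t a b cr = subst₂ LiftsCross
    (trans (lift-translate s (s′ - s) a) (cong (λ z → lift z a) (ring s s′)))
    (lift-translate t (s′ - s) b)
    (LiftsCross-translate ((s′ - s) * + N) (lift s a) (lift t b) cr)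
    where
    ring : ∀ s s′ → s + (s′ - s) ≡ s′
    ring = solve-∀

  -- The starting points of two lifts differ by a multiple of `N`, which leaves no room strictly
  -- inside a length of at most `N`.
  embedded : ∀ i d s t → d ℕ.≤ N → point i s < point i t → ¬ point i t < point i s + + d
  embedded i d s t d≤N p q with <-≤-connex s t
  ... | inj₁ s<t = 0≰-1 (0≤-resp (ring (+ toℕ i) s t (+ N) (+ d))
      (0≤+ (gap≥0 q) (0≤+ (i≤j⇒0≤j-i (+≤+ d≤N)) (0≤* (gap≥0 s<t) (+≤+ (ℕ.z≤n {N}))))))
    where
    ring : ∀ i s t n d → i + s * n + d - (1ℤ + (i + t * n)) + (n - d + (t - (1ℤ + s)) * n) ≡ -1ℤ
    ring = solve-∀
  ... | inj₂ t≤s = 0≰-1 (0≤-resp (ring (+ toℕ i) s t (+ N))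
      (0≤+ (gap≥0 p) (0≤* (i≤j⇒0≤j-i t≤s) (+≤+ (ℕ.z≤n {N})))))
    where
    ring : ∀ i s t n → i + t * n - (1ℤ + (i + s * n)) + (s - t) * n ≡ -1ℤ
    ring = solve-∀

  bridging-arc : ∀ (i : Fin N) → IsArc (bridging i)
  bridging-arc i = (λ ()) , (λ ()) , λ ()

  peripheral-arc : ∀ (i : Fin N) d → 2 ℕ.≤ d → d ℕ.≤ N → IsArc (peripheral i d)
  peripheral-arc i d 2≤d d≤N = (λ { (constant _) → ℕ.n≮0 2≤d }) , (λ { (segment _) → ℕ.n≮n 1 2≤d }) ,
    λ { (s , t , inj₁ (p , q , _)) → embedded i d s t d≤N p q
      ; (s , t , inj₂ (p , q , _)) → embedded i d t s d≤N p q }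

  arc-range : ∀ {i : Fin N} {d} → IsArc (peripheral i d) → 2 ℕ.≤ d × d ℕ.≤ N
  arc-range {i} {zero} (nc , _)            = ⊥-elim (nc (constant i))
  arc-range {i} {suc zero} (_ , nb , _)    = ⊥-elim (nb (segment i))
  arc-range {i} {d@(suc (suc _))} (_ , _ , nx) = ℕ.s≤s (ℕ.s≤s ℕ.z≤n) , ℕ.≮⇒≥ λ N<d →
    -- A curve longer than `N` is linked with its translate by one turn.
    nx (0ℤ , 1ℤ , inj₁ (gap≥0⇒< (0≤-resp (ring (+ toℕ i) (+ N)) (gap≥0 (+<+ (ℕ.>-nonZero⁻¹ N))))
                      , gap≥0⇒< (0≤-resp (ring′ (+ toℕ i) (+ N) (+ d)) (gap≥0 (+<+ N<d)))
                      , gap≥0⇒< (0≤-resp (ring″ (+ toℕ i) (+ N) (+ d)) (gap≥0 (+<+ (ℕ.>-nonZero⁻¹ N))))))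
    where
    ring : ∀ i n → n - (1ℤ + 0ℤ) ≡ i + 1ℤ * n - (1ℤ + (i + 0ℤ * n))
    ring = solve-∀
    ring′ : ∀ i n d → d - (1ℤ + n) ≡ i + 0ℤ * n + d - (1ℤ + (i + 1ℤ * n))
    ring′ = solve-∀
    ring″ : ∀ i n d → n - (1ℤ + 0ℤ) ≡ i + 1ℤ * n + d - (1ℤ + (i + 0ℤ * n + d))
    ring″ = solve-∀

  count : Curve N → List (Curve N) → ℤ
  count c []       = 0ℤ
  count c (b ∷ bs) = 𝟙 (b ≟ᶜ c) + count c bs

  count-∉ : ∀ {c} bs → All (λ b → c ≢ b) bs → count c bs ≡ 0ℤ
  count-∉ []       []        = refl
  count-∉ {c} (b ∷ bs) (c≢b ∷ ps) = cong₂ _+_ (𝟙-no (b ≟ᶜ c) (λ e → c≢b (sym e))) (count-∉ bs ps)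

  count-∈ : ∀ {c bs} → Unique bs → c ∈ bs → count c bs ≡ 1ℤ
  count-∈ {c} {b ∷ bs} (b∉ ∷ _) (here refl) = cong₂ _+_ (𝟙-yes (b ≟ᶜ c) refl) (count-∉ bs b∉)
  count-∈ {c} {b ∷ bs} (b∉ ∷ u) (there c∈)  = cong₂ _+_ (𝟙-no (b ≟ᶜ c) (All.lookup b∉ c∈)) (count-∈ u c∈)

  count-unique : ∀ {bs} → Unique bs → ∀ c → count c bs ≡ 𝟙 (c ∈? bs)
  count-unique {bs} u c with c ∈? bs
  ... | yes c∈ = count-∈ u c∈
  ... | no  c∉ = count-∉ bs (All.tabulate λ b∈ e → c∉ (subst (_∈ bs) (sym e) b∈))

  -- The start of the curve of length `d` that ends at `i`.
  before : Fin N → ℕ → Fin N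
  before i d = residue (+ toℕ i - + d)

  before-mod : ∀ {i j} d → i ≡ (toℕ j ℕ.+ d) mod N → j ≡ before i d
  before-mod {i} {j} d refl = sym (residue-unique _ j (- t) (trans (cong (_- + d) e) (ring (+ toℕ j) (+ d) t (+ N))))
    where
    w = + (toℕ j ℕ.+ d)
    t = turns w
    e : + toℕ (residue w) ≡ + toℕ j + + d - t * + N
    e = trans (lem (+ toℕ (residue w)) (t * + N)) (cong (_- t * + N) (trans (point-residue w) (pos-+ (toℕ j) d)))
      where
      lem : ∀ u v → u ≡ u + v - v
      lem = solve-∀
    ring : ∀ j d t n → j + d - t * n - d ≡ j + (- t) * n
    ring = solve-∀

  mod-before : ∀ i d → i ≡ (toℕ (before i d) ℕ.+ d) mod N
  mod-before i d = sym (residue-unique _ i (- t)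
    (trans (trans (pos-+ (toℕ (before i d)) d) (lem (+ toℕ (before i d)) (+ d) (t * + N)))
      (trans (cong (λ z → z + + d - t * + N) (point-residue (+ toℕ i - + d))) (ring (+ toℕ i) (+ d) t (+ N)))))
    where
    t = turns (+ toℕ i - + d)
    lem : ∀ j d w → j + d ≡ j + w + d - w
    lem = solve-∀
    ring : ∀ i d t n → i - d + d - t * n ≡ i + (- t) * n
    ring = solve-∀

  sumTo-single : ∀ g {e k} → 1 ℕ.≤ e → e ℕ.≤ k → (∀ d → d ≢ e → g d ≡ 0ℤ) → sumTo g k ≡ g e
  sumTo-single g {suc e} {k} _ e≤k z = trans (sumTo-tail g e≤k λ d e<d _ → z d λ { refl → ℕ.<-irrefl refl e<d })
    (trans (cong (_+ g (suc e)) (sumTo-zero g e λ d _ d≤e → z d λ { refl → ℕ.<-irrefl refl d≤e })) (+-identityˡ (g (suc e))))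

  endsAt : Fin N → List (Curve N) → ℤ
  endsAt i cs = + length (filter (i Fin.≟_) (concatMap boundaryEnds cs))

  length-filter-∷ : ∀ (i j : Fin N) js → + length (filter (i Fin.≟_) (j ∷ js)) ≡ 𝟙 (i Fin.≟ j) + + length (filter (i Fin.≟_) js)
  length-filter-∷ i j js with i Fin.≟ j
  ... | yes _ = refl
  ... | no  _ = sym (+-identityˡ _)

  -- Each peripheral arc is counted once at its start and once at its end.
  incidences : Fin N → (Curve N → ℤ) → ℤ
  incidences i g = g (bridging i) + sumTo (λ d → g (peripheral i d)) N + sumTo (λ d → g (peripheral (before i d) d)) N

  incidences-+ : ∀ i g h → incidences i (λ c → g c + h c) ≡ incidences i g + incidences i h
  incidences-+ i g h = trans (cong₂ (λ u v → g (bridging i) + h (bridging i) + u + v)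
      (sumTo-+ (λ d → g (peripheral i d)) (λ d → h (peripheral i d)) N)
      (sumTo-+ (λ d → g (peripheral (before i d) d)) (λ d → h (peripheral (before i d) d)) N))
    (ring (g (bridging i)) (h (bridging i)) (sumTo (λ d → g (peripheral i d)) N) (sumTo (λ d → h (peripheral i d)) N)
      (sumTo (λ d → g (peripheral (before i d) d)) N) (sumTo (λ d → h (peripheral (before i d) d)) N))
    where
    ring : ∀ a a′ b b′ c c′ → a + a′ + (b + b′) + (c + c′) ≡ (a + b + c) + (a′ + b′ + c′)
    ring = solve-∀

  incidences-cong : ∀ i {g h} → (∀ c → g c ≡ h c) → incidences i g ≡ incidences i h
  incidences-cong i {g} {h} e = cong₂ _+_ (cong₂ _+_ (e (bridging i))
    (sumTo-cong N λ d _ _ → e (peripheral i d))) (sumTo-cong N λ d _ _ → e (peripheral (before i d) d))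

  incidences-zero : ∀ i → incidences i (λ _ → 0ℤ) ≡ 0ℤ
  incidences-zero i = cong₂ (λ u v → 0ℤ + u + v) (sumTo-zero _ N λ _ _ _ → refl) (sumTo-zero _ N λ _ _ _ → refl)

  boundaryEnds-incidences : ∀ i (c : Curve N) js → IsArc c →
    + length (filter (i Fin.≟_) (boundaryEnds c Data.List.++ js)) ≡
    incidences i (λ b → 𝟙 (c ≟ᶜ b)) + + length (filter (i Fin.≟_) js)
  boundaryEnds-incidences i c@(bridging j) js _ = trans (length-filter-∷ i j js)
    (cong (_+ + length (filter (i Fin.≟_) js)) (sym
      (trans (cong₂ (λ u v → 𝟙 (c ≟ᶜ bridging i) + u + v)
        (sumTo-zero _ N λ d _ _ → 𝟙-no (c ≟ᶜ peripheral i d) λ ())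
        (sumTo-zero _ N λ d _ _ → 𝟙-no (c ≟ᶜ peripheral (before i d) d) λ ()))
       (trans (+-identityʳ _) (trans (+-identityʳ _)
        (𝟙-cong (c ≟ᶜ bridging i) (i Fin.≟ j) (λ { refl → refl }) λ { refl → refl }))))))
  boundaryEnds-incidences i c@(peripheral j e) js arc with arc-range arc
  ... | 2≤e , e≤N = begin
    + length (filter (i Fin.≟_) (j ∷ k ∷ js))   ≡⟨ length-filter-∷ i j (k ∷ js) ⟩
    𝟙 (i Fin.≟ j) + + length (filter (i Fin.≟_) (k ∷ js)) ≡⟨ cong (λ z → 𝟙 (i Fin.≟ j) + z) (length-filter-∷ i k js) ⟩
    𝟙 (i Fin.≟ j) + (𝟙 (i Fin.≟ k) + R)        ≡⟨ ring (𝟙 (i Fin.≟ j)) (𝟙 (i Fin.≟ k)) R ⟩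
    0ℤ + 𝟙 (i Fin.≟ j) + 𝟙 (i Fin.≟ k) + R     ≡⟨ cong (_+ R) (sym total) ⟩
    incidences i (λ b → 𝟙 (c ≟ᶜ b)) + R        ∎
    where
    open ≡-Reasoning
    k = (toℕ j ℕ.+ e) mod N
    R = + length (filter (i Fin.≟_) js)
    1≤e = ℕ.<⇒≤ 2≤e
    ring : ∀ u v w → u + (v + w) ≡ 0ℤ + u + v + w
    ring = solve-∀
    total : incidences i (λ b → 𝟙 (c ≟ᶜ b)) ≡ 0ℤ + 𝟙 (i Fin.≟ j) + 𝟙 (i Fin.≟ k)
    total = cong₂ _+_ (cong₂ _+_ (𝟙-no (c ≟ᶜ bridging i) λ ())
      (trans (sumTo-single _ 1≤e e≤N λ d d≢e → 𝟙-no (c ≟ᶜ peripheral i d) λ { refl → d≢e refl })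
        (𝟙-cong (c ≟ᶜ peripheral i e) (i Fin.≟ j) (λ { refl → refl }) λ { refl → refl })))
      (trans (sumTo-single _ 1≤e e≤N λ d d≢e → 𝟙-no (c ≟ᶜ peripheral (before i d) d) λ { refl → d≢e refl })
        (𝟙-cong (c ≟ᶜ peripheral (before i e) e) (i Fin.≟ k)
          (λ { refl → mod-before i e })
          λ p → cong (λ z → peripheral z e) (before-mod e p)))

  endsAt-count : ∀ i cs → (∀ {c} → c ∈ cs → IsArc c) → endsAt i cs ≡ incidences i (λ c → count c cs)
  endsAt-count i []       _  = sym (incidences-zero i)
  endsAt-count i (c ∷ cs) ar = trans (boundaryEnds-incidences i c (concatMap boundaryEnds cs) (ar (here refl)))
    (trans (cong (λ z → incidences i (λ b → 𝟙 (c ≟ᶜ b)) + z) (endsAt-count i cs (λ p → ar (there p))))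
      (sym (incidences-+ i (λ b → 𝟙 (c ≟ᶜ b)) (λ b → count b cs))))

  regionsAt-incidences : ∀ (T : Triangulation N) i →
    + regionsAt T i ≡ 1ℤ + incidences i (λ c → 𝟙 (c ∈? arcs T))
  regionsAt-incidences T i = cong (λ z → 1ℤ + z) (trans (endsAt-count i (arcs T) (areArcs T))
    (incidences-cong i (count-unique (distinct T))))

-- Triangulations of the punctured disc as periodic triangulations

module Correspondence (N : ℕ) .{{nz : NonZero N}} where

  open MarkedPoints N

  N≥1 : 1 ℕ.≤ N
  N≥1 = ℕ.>-nonZero⁻¹ N

  -- Stated for arbitrary chords and rays matching the arcs, because both passages between the two
  -- kinds of triangulation count in this way. The boundary segments are chords but not arcs, so
  -- each sum exceeds its number of arcs by one.
  regions-degree : ∀ (T : Triangulation N)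
    {Chord : ℤ → ℤ → Set} {Ray : ℤ → Set} (chord? : ∀ x y → Dec (Chord x y)) (ray? : ∀ x → Dec (Ray x)) →
    (∀ x → Chord x (x + 1ℤ)) →
    (∀ x d → Chord x (x + + suc (suc d)) → peripheral (residue x) (suc (suc d)) ∈ arcs T) →
    (∀ x d → peripheral (residue x) d ∈ arcs T → Chord x (x + + d)) →
    (∀ x → Ray x → bridging (residue x) ∈ arcs T) → (∀ x → bridging (residue x) ∈ arcs T → Ray x) →
    ∀ x → + regionsAt T (residue x) ≡
      sumTo (λ d → 𝟙 (chord? x (x + + d))) N + sumTo (λ d → 𝟙 (chord? (x - + d) x)) N - 1ℤ + 𝟙 (ray? x)
  regions-degree T {Chord} chord? ray? seg c→ →c r→ →r x = begin
    + regionsAt T i                        ≡⟨ regionsAt-incidences T i ⟩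
    1ℤ + (𝟙 (bridging i ∈? arcs T) + R + L) ≡⟨ ring (𝟙 (bridging i ∈? arcs T)) R L ⟩
    (1ℤ + R) + (1ℤ + L) - 1ℤ + 𝟙 (bridging i ∈? arcs T)
      ≡⟨ cong₂ (λ u v → u + v - 1ℤ + 𝟙 (bridging i ∈? arcs T)) (sym right) (sym left) ⟩
    _ ≡⟨ cong (λ v → sumTo (λ d → 𝟙 (chord? x (x + + d))) N + sumTo (λ d → 𝟙 (chord? (x - + d) x)) N - 1ℤ + v)
         (𝟙-cong (bridging i ∈? arcs T) (ray? x) (→r x) (r→ x)) ⟩
    _ ∎
    where
    open ≡-Reasoning
    i = residue x
    R = sumTo (λ d → 𝟙 (peripheral i d ∈? arcs T)) N
    L = sumTo (λ d → 𝟙 (peripheral (before i d) d ∈? arcs T)) N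
    ring : ∀ b r l → 1ℤ + (b + r + l) ≡ (1ℤ + r) + (1ℤ + l) - 1ℤ + b
    ring = solve-∀
    boundary-edge : sumTo (λ d → 𝟙 (d ℕ.≟ 1)) N ≡ 1ℤ
    boundary-edge = sumTo-single _ ℕ.≤-refl N≥1 λ d d≢1 → 𝟙-no (d ℕ.≟ 1) d≢1
    edge : ∀ z d → 1 ℕ.≤ d → 𝟙 (chord? z (z + + d)) ≡ 𝟙 (d ℕ.≟ 1) + 𝟙 (peripheral (residue z) d ∈? arcs T)
    edge z 1 _ = trans (𝟙-yes (chord? z (z + 1ℤ)) (seg z))
      (cong (λ v → 1ℤ + v) (sym (𝟙-no (peripheral (residue z) 1 ∈? arcs T) λ p → ℕ.n≮n 1 (proj₁ (arc-range (areArcs T p))))))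
    edge z d@(suc (suc e)) _ = trans (𝟙-cong (chord? z (z + + d)) (peripheral (residue z) d ∈? arcs T) (c→ z e) (→c z d))
      (sym (+-identityˡ _))
    right : sumTo (λ d → 𝟙 (chord? x (x + + d))) N ≡ 1ℤ + R
    right = trans (sumTo-cong N λ d 1≤d _ → edge x d 1≤d)
      (trans (sumTo-+ (λ d → 𝟙 (d ℕ.≟ 1)) (λ d → 𝟙 (peripheral i d ∈? arcs T)) N) (cong (_+ R) boundary-edge))
    before-residue : ∀ d → residue (x - + d) ≡ before i d
    before-residue d = trans (cong residue (trans (cong (_- + d) (sym (point-residue x))) (ring′ (+ toℕ i) (turns x * + N) (+ d))))
      (residue-shift (+ toℕ i - + d) (turns x))
      where
      ring′ : ∀ u v w → u + v - w ≡ u - w + v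
      ring′ = solve-∀
    x-d+d : ∀ x d → x ≡ x - d + d
    x-d+d = solve-∀
    left-edge : ∀ d → 1 ℕ.≤ d → 𝟙 (chord? (x - + d) x) ≡ 𝟙 (d ℕ.≟ 1) + 𝟙 (peripheral (before i d) d ∈? arcs T)
    left-edge d 1≤d = trans
      (𝟙-cong (chord? (x - + d) x) (chord? (x - + d) (x - + d + + d)) (subst (Chord _) (x-d+d x (+ d))) (subst (Chord _) (sym (x-d+d x (+ d)))))
      (trans (edge (x - + d) d 1≤d) (cong (λ j → 𝟙 (d ℕ.≟ 1) + 𝟙 (peripheral j d ∈? arcs T)) (before-residue d)))
    left : sumTo (λ d → 𝟙 (chord? (x - + d) x)) N ≡ 1ℤ + L
    left = trans (sumTo-cong N λ d 1≤d _ → left-edge d 1≤d)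
      (trans (sumTo-+ (λ d → 𝟙 (d ℕ.≟ 1)) (λ d → 𝟙 (peripheral (before i d) d ∈? arcs T)) N) (cong (_+ L) boundary-edge))

  x<u<x+1 : ∀ {x u y} → y ≡ x + 1ℤ → x < u → u < y → ⊥
  x<u<x+1 {x} {u} refl p q = 0≰-1 (0≤-resp (ring x u) (0≤+ (gap≥0 p) (gap≥0 q)))
    where
    ring : ∀ x u → u - (1ℤ + x) + (x + 1ℤ - (1ℤ + u)) ≡ -1ℤ
    ring = solve-∀

  module FromTriangulation (T : Triangulation N) where

    Edge : ℤ → ℕ → Set
    Edge x d = d ≡ 1 ⊎ peripheral (residue x) d ∈ arcs T

    Chord : ℤ → ℤ → Set
    Chord x y = ∃[ d ] (y ≡ x + + d × Edge x d)

    Ray : ℤ → Set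
    Ray x = bridging (residue x) ∈ arcs T

    edge? : ∀ x d → Dec (Edge x d)
    edge? x d = (d ℕ.≟ 1) ⊎-dec (peripheral (residue x) d ∈? arcs T)

    gap-injective : ∀ x {d e} → x + + d ≡ x + + e → d ≡ e
    gap-injective x {d} {e} p = +-injective (trans (ring x (+ d)) (trans (cong (_- x) p) (sym (ring x (+ e)))))
      where
      ring : ∀ x d → d ≡ x + d - x
      ring = solve-∀

    chord? : ∀ x y → Dec (Chord x y)
    chord? x y with x ≤? y
    ... | no x≰y = no λ { (d , refl , _) → x≰y (subst (_≤ x + + d) (+-identityʳ x) (shift-≤ x (ℕ.z≤n {d}))) }
    ... | yes x≤y with ≤-gap x≤y
    ...   | d , refl = map′ (λ e → d , refl , e)
            (λ { (d′ , eq , e) → subst (Edge x) (sym (gap-injective x eq)) e }) (edge? x d)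

    edge-range : ∀ {x d} → Edge x d → 1 ℕ.≤ d × d ℕ.≤ N
    edge-range (inj₁ refl) = ℕ.≤-refl , N≥1
    edge-range (inj₂ p) with arc-range (areArcs T p)
    ... | 2≤d , d≤N = ℕ.<⇒≤ 2≤d , d≤N

    lift-chord : ∀ t i d → peripheral i d ∈ arcs T → Chord (point i t) (point i t + + d)
    lift-chord t i d p = d , refl , inj₂ (subst (λ j → peripheral j d ∈ arcs T) (sym (residue-point i t)) p)

    lift-ray : ∀ t i → bridging i ∈ arcs T → Ray (point i t)
    lift-ray t i p = subst (λ j → bridging j ∈ arcs T) (sym (residue-point i t)) p

    no-cross : ∀ {a b} → a ∈ arcs T → b ∈ arcs T → ∀ s t {A B} → lift s a ≡ A → lift t b ≡ B → ¬ LiftsCross A B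
    no-cross p q s t refl refl cr = nonCrossing T p q (s , t , cr)

    chord-< : ∀ {x y} → Chord x y → x < y
    chord-< {x} (d , refl , e) = subst (_< x + + d) (+-identityʳ x) (shift-< x (proj₁ (edge-range {x} e)))

    chord-chord : ∀ {x y u v} → Chord x y → Chord u v → x < u → u < y → y < v → ⊥
    chord-chord (_ , eq , inj₁ refl) _ p q r = x<u<x+1 eq p q
    chord-chord _ (_ , eq , inj₁ refl) p q r = x<u<x+1 eq q r
    chord-chord {x} {_} {u} (d , refl , inj₂ c) (e , refl , inj₂ c′) p q r =
      no-cross c c′ (turns x) (turns u) (lift-peripheral x d) (lift-peripheral u e) (inj₁ (p , q , r))

    chord-ray : ∀ {x y z} → Chord x y → Ray z → x < z → z < y → ⊥
    chord-ray (_ , eq , inj₁ refl) _ p q = x<u<x+1 eq p q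
    chord-ray {x} {_} {z} (d , refl , inj₂ c) r p q =
      no-cross c r (turns x) (turns z) (lift-peripheral x d) (lift-bridging z) (p , q)

    chord-maximal : ∀ x y → x < y → y ≤ x + + N →
      (∀ {u v} → Chord u v → x < u → u < y → y < v → ⊥) →
      (∀ {u v} → Chord u v → u < x → x < v → v < y → ⊥) →
      (∀ {z} → Ray z → x < z → z < y → ⊥) → Chord x y
    chord-maximal x y x<y y≤x+N right left no-ray with <-gap x<y
    ... | zero , refl = 1 , refl , inj₁ refl
    ... | d′@(suc _) , refl = d , refl , inj₂ (maximal T c
        (peripheral-arc (residue x) d (ℕ.s≤s (ℕ.s≤s ℕ.z≤n)) (ℕ.≮⇒≥ λ N<d → <-irrefl refl (<-≤-trans (shift-< x N<d) y≤x+N)))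
        λ { {b} b∈ (s , t , cr) → avoid b (t + (turns x - s)) b∈
              (subst (λ A → LiftsCross A (lift (t + (turns x - s)) b)) (lift-peripheral x d) (LiftsCross-align s (turns x) t c b cr)) })
      where
      d = suc d′
      c = peripheral (residue x) d
      avoid : ∀ b t → b ∈ arcs T → ¬ LiftsCross (chord x (x + + d)) (lift t b)
      avoid (bridging i)     t b∈ (p , q)            = no-ray (lift-ray t i b∈) p q
      avoid (peripheral i e) t b∈ (inj₁ (p , q , r)) = right (lift-chord t i e b∈) p q r
      avoid (peripheral i e) t b∈ (inj₂ (p , q , r)) = left (lift-chord t i e b∈) p q r

    ray-maximal : ∀ x → (∀ {u v} → Chord u v → u < x → x < v → ⊥) → Ray x
    ray-maximal x none = maximal T c (bridging-arc (residue x))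
      λ { {b} b∈ (s , t , cr) → avoid b (t + (turns x - s)) b∈
            (subst (λ A → LiftsCross A (lift (t + (turns x - s)) b)) (lift-bridging x) (LiftsCross-align s (turns x) t c b cr)) }
      where
      c = bridging (residue x)
      avoid : ∀ b t → b ∈ arcs T → ¬ LiftsCross (ray x) (lift t b)
      avoid (peripheral i e) t b∈ (p , q) = none (lift-chord t i e b∈) p q

    swap : ∀ x n d → x + d + n ≡ x + n + d
    swap = solve-∀

    periodicTriangulation : PeriodicTriangulation N (λ x → + regionsAt T (residue x))
    periodicTriangulation = record
      { Chord = Chord ; Ray = Ray ; chord? = chord? ; ray? = λ x → bridging (residue x) ∈? arcs T
      ; chord-< = chord-<
      ; chord-≤ = λ { {x} (d , refl , e) → shift-≤ x (proj₂ (edge-range {x} e)) }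
      ; boundary = boundary
      ; chord-shift = λ { {x} (d , refl , e) → d , swap x (+ N) (+ d) , subst (λ j → d ≡ 1 ⊎ peripheral j d ∈ arcs T) (sym (residue-period x)) e }
      ; chord-unshift = λ { {x} {y} (d , eq , e) → d , unshift x y (+ d) eq , subst (λ j → d ≡ 1 ⊎ peripheral j d ∈ arcs T) (residue-period x) e }
      ; ray-shift = λ {x} → subst (λ j → bridging j ∈ arcs T) (sym (residue-period x))
      ; ray-unshift = λ {x} → subst (λ j → bridging j ∈ arcs T) (residue-period x)
      ; chord-chord = chord-chord
      ; chord-ray = chord-ray
      ; chord-maximal = chord-maximal
      ; ray-maximal = ray-maximal
      ; degree = regions-degree T chord? (λ x → bridging (residue x) ∈? arcs T) boundary
          (λ x d c → long x d c) (λ x d c → d , refl , inj₂ c) (λ _ r → r) (λ _ r → r)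
      }
      where
      boundary : ∀ x → Chord x (x + 1ℤ)
      boundary x = 1 , refl , inj₁ refl
      long : ∀ x d → Chord x (x + + suc (suc d)) → peripheral (residue x) (suc (suc d)) ∈ arcs T
      long x d (e , eq , c) with gap-injective x {suc (suc d)} {e} eq | c
      ... | refl | inj₂ c∈ = c∈
      unshift : ∀ x y d → y + + N ≡ x + + N + d → y ≡ x + d
      unshift x y d e = trans (ring y (+ N)) (trans (cong (_- + N) e) (ring′ x (+ N) d))
        where
        ring : ∀ y n → y ≡ y + n - n
        ring = solve-∀
        ring′ : ∀ x n d → x + n + d - n ≡ x + d
        ring′ = solve-∀

  module ToTriangulation {a : ℤ → ℤ} (P : PeriodicTriangulation N a) where

    open PeriodicTriangulation P

    -- Every curve is tested at its lift of turn 0. The bound `2 ℕ.≤ d` removes the boundary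
    -- segments, which are chords but not arcs.
    Marked : Curve N → Set
    Marked (bridging i)     = Ray (point i 0ℤ)
    Marked (peripheral i d) = 2 ℕ.≤ d × Chord (point i 0ℤ) (point i 0ℤ + + d)

    marked? : ∀ c → Dec (Marked c)
    marked? (bridging i)     = ray? (point i 0ℤ)
    marked? (peripheral i d) = (2 ℕ.≤? d) ×-dec chord? (point i 0ℤ) (point i 0ℤ + + d)

    -- The length `N` is included: it belongs to the loops around the puncture.
    candidates : List (Curve N)
    candidates = map bridging (allFin N) ++ cartesianProductWith peripheral (allFin N) (upTo (suc N))

    markedCurves : List (Curve N)
    markedCurves = deduplicate _≟ᶜ_ (filter marked? candidates)

    all-turns : (Q : ℤ → Set) → (∀ t → Q t → Q (t + 1ℤ)) → (∀ t → Q (t + 1ℤ) → Q t) → ∀ s t → Q s → Q t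
    all-turns Q up down s t q = ℤ-induction (λ t → Q 0ℤ → Q t) (λ z → z) (λ t f z → up t (f z)) (λ t f z → down t (f z)) t
      (ℤ-induction (λ s → Q s → Q 0ℤ) (λ z → z) (λ s f z → f (down s z)) (λ s f z → f (up s z)) s q)

    point-next : ∀ i t → point i t + + N ≡ point i (t + 1ℤ)
    point-next i t = ring (+ toℕ i) t (+ N)
      where
      ring : ∀ i t n → i + t * n + n ≡ i + (t + 1ℤ) * n
      ring = solve-∀

    ray-turns : ∀ i s t → Ray (point i s) → Ray (point i t)
    ray-turns i = all-turns (λ t → Ray (point i t)) (λ t r → subst Ray (point-next i t) (ray-shift r))
      (λ t r → ray-unshift (subst Ray (sym (point-next i t)) r))

    chord-turns : ∀ i d s t → Chord (point i s) (point i s + + d) → Chord (point i t) (point i t + + d)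
    chord-turns i d = all-turns (λ t → Chord (point i t) (point i t + + d))
      (λ t c → subst₂ Chord (point-next i t) (eq t) (chord-shift c))
      (λ t c → chord-unshift (subst₂ Chord (sym (point-next i t)) (sym (eq t)) c))
      where
      swap : ∀ x n d → x + d + n ≡ x + n + d
      swap = solve-∀
      eq : ∀ t → point i t + + d + + N ≡ point i (t + 1ℤ) + + d
      eq t = trans (swap (point i t) (+ N) (+ d)) (cong (_+ + d) (point-next i t))

    gap≤N : ∀ {x d} → Chord x (x + + d) → d ℕ.≤ N
    gap≤N {x} c = ℕ.≮⇒≥ λ N<d → <-irrefl refl (<-≤-trans (shift-< x N<d) (chord-≤ c))

    marked⇒∈ : ∀ c → Marked c → c ∈ markedCurves
    marked⇒∈ c mk = ∈-deduplicate⁺ _≟ᶜ_ (∈-filter⁺ marked? (candidate c mk) mk)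
      where
      candidate : ∀ c → Marked c → c ∈ candidates
      candidate (bridging i)     _       = ∈-++⁺ˡ (∈-map⁺ bridging (∈-allFin i))
      candidate (peripheral i d) (_ , c) = ∈-++⁺ʳ (map bridging (allFin N))
        (∈-cartesianProductWith⁺ peripheral (∈-allFin i) (∈-upTo⁺ (ℕ.s≤s (gap≤N c))))

    ∈⇒marked : ∀ {c} → c ∈ markedCurves → Marked c
    ∈⇒marked p = proj₂ (∈-filter⁻ marked? {xs = candidates} (∈-deduplicate⁻ _≟ᶜ_ (filter marked? candidates) p))

    ray⇒∈ : ∀ x → Ray x → bridging (residue x) ∈ markedCurves
    ray⇒∈ x r = marked⇒∈ _ (ray-turns (residue x) (turns x) 0ℤ (subst Ray (sym (point-residue x)) r))

    ∈⇒ray : ∀ t {i} → bridging i ∈ markedCurves → Ray (point i t)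
    ∈⇒ray t {i} p = ray-turns i 0ℤ t (∈⇒marked p)

    chord⇒∈ : ∀ x d → Chord x (x + + suc (suc d)) → peripheral (residue x) (suc (suc d)) ∈ markedCurves
    chord⇒∈ x d c = marked⇒∈ _ (ℕ.s≤s (ℕ.s≤s ℕ.z≤n) , chord-turns (residue x) (suc (suc d)) (turns x) 0ℤ
      (subst (λ z → Chord z (z + + suc (suc d))) (sym (point-residue x)) c))

    ∈⇒chord : ∀ t {i d} → peripheral i d ∈ markedCurves → Chord (point i t) (point i t + + d)
    ∈⇒chord t {i} {d} p = chord-turns i d 0ℤ t (proj₂ (∈⇒marked p))

    ∈⇒arc : ∀ {c} → c ∈ markedCurves → IsArc c
    ∈⇒arc {bridging i}     p = bridging-arc i
    ∈⇒arc {peripheral i d} p = peripheral-arc i d (proj₁ (∈⇒marked p)) (gap≤N (proj₂ (∈⇒marked p)))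

    uncrossed : ∀ {b c} → b ∈ markedCurves → c ∈ markedCurves → ¬ Cross b c
    uncrossed {bridging i}     {peripheral j e} p q (s , t , l , r) = chord-ray (∈⇒chord t q) (∈⇒ray s p) l r
    uncrossed {peripheral i d} {bridging j}     p q (s , t , l , r) = chord-ray (∈⇒chord s p) (∈⇒ray t q) l r
    uncrossed {peripheral i d} {peripheral j e} p q (s , t , inj₁ (u , v , w)) = chord-chord (∈⇒chord s p) (∈⇒chord t q) u v w
    uncrossed {peripheral i d} {peripheral j e} p q (s , t , inj₂ (u , v , w)) = chord-chord (∈⇒chord t q) (∈⇒chord s p) u v w

    lifts-uncrossed : ∀ {c} t → (∀ {b} → b ∈ markedCurves → ¬ Cross c b) → ∀ {b} → b ∈ markedCurves →
      ∀ s {B} → lift s b ≡ B → ¬ LiftsCross (lift t c) B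
    lifts-uncrossed t none p s refl cr = none p (t , s , cr)

    -- A chord of length 1 has no marked point strictly inside and crosses nothing; every longer
    -- chord is a lift of a marked curve. So avoiding the marked curves amounts to avoiding all
    -- chords and rays.
    complete : ∀ c → IsArc c → (∀ {b} → b ∈ markedCurves → ¬ Cross c b) → c ∈ markedCurves
    complete (bridging i) _ none = marked⇒∈ _ (ray-maximal (point i 0ℤ) avoid)
      where
      avoid : ∀ {u v} → Chord u v → u < point i 0ℤ → point i 0ℤ < v → ⊥
      avoid {u} c p q with <-gap (chord-< c)
      ... | zero , eq    = x<u<x+1 eq p q
      ... | suc d , refl = lifts-uncrossed {bridging i} 0ℤ none (chord⇒∈ u d c) (turns u) (lift-peripheral u (suc (suc d))) (p , q)
    complete (peripheral i d) arc none with arc-range arc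
    ... | 2≤d , d≤N = marked⇒∈ _ (2≤d , chord-maximal x (x + + d)
        (subst (_< x + + d) (+-identityʳ x) (shift-< x (ℕ.<⇒≤ 2≤d))) (shift-≤ x d≤N)
        right left λ {z} r p q → lifts-uncrossed {peripheral i d} 0ℤ none (ray⇒∈ z r) (turns z) (lift-bridging z) (p , q))
      where
      x = point i 0ℤ
      right : ∀ {u v} → Chord u v → x < u → u < x + + d → x + + d < v → ⊥
      right {u} c p q r with <-gap (chord-< c)
      ... | zero , eq    = x<u<x+1 eq q r
      ... | suc e , refl = lifts-uncrossed {peripheral i d} 0ℤ none (chord⇒∈ u e c) (turns u) (lift-peripheral u (suc (suc e))) (inj₁ (p , q , r))
      left : ∀ {u v} → Chord u v → u < x → x < v → v < x + + d → ⊥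
      left {u} c p q r with <-gap (chord-< c)
      ... | zero , eq    = x<u<x+1 eq p q
      ... | suc e , refl = lifts-uncrossed {peripheral i d} 0ℤ none (chord⇒∈ u e c) (turns u) (lift-peripheral u (suc (suc e))) (inj₂ (p , q , r))

    triangulation : Triangulation N
    triangulation = record
      { arcs        = markedCurves
      ; distinct    = Unique.deduplicate-! _≟ᶜ_ (filter marked? candidates)
      ; areArcs     = ∈⇒arc
      ; nonCrossing = uncrossed
      ; maximal     = complete
      }

    regionsAt-triangulation : ∀ x → a x ≡ + regionsAt triangulation (residue x)
    regionsAt-triangulation x = trans (degree x) (sym (regions-degree triangulation chord? ray? boundary chord⇒∈
      (λ x d p → subst (λ z → Chord z (z + + d)) (point-residue x) (∈⇒chord (turns x) p)) ray⇒∈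
      (λ x p → subst Ray (point-residue x) (∈⇒ray (turns x) p)) x))

-- The triangulation of a frieze with trace 2

1≢pos+pos : ∀ {u v} → 0ℤ < u → 0ℤ < v → 1ℤ ≡ u + v → ⊥
1≢pos+pos {u} {v} p q e = 0≰-1 (0≤-resp (trans (ring u v) (cong (_- + 2) (sym e))) (0≤+ (gap≥0 p) (gap≥0 q)))
  where
  ring : ∀ u v → u - (1ℤ + 0ℤ) + (v - (1ℤ + 0ℤ)) ≡ u + v - + 2
  ring = solve-∀

-- The fractions E d / G d form a decreasing chain of Farey neighbours, so the
-- chain meets every integer it passes, exactly at the denominators 1.
module FareyChain (E G : ℕ → ℤ) (A : ℤ) (G1 : G 1 ≡ 1ℤ) (E1 : E 1 ≡ A) (G-pos : ∀ d → 0ℤ < G (suc d))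
  (adjacent : ∀ d → E (suc d) * G (2 ℕ.+ d) - E (2 ℕ.+ d) * G (suc d) ≡ 1ℤ)
  {Unit : ℕ → Set} (unit? : ∀ d → Dec (Unit d)) (unit⇒ : ∀ {d} → Unit d → G d ≡ 1ℤ)
  (⇒unit : ∀ {d} → G (suc d) ≡ 1ℤ → Unit (suc d)) where

  -- The least integer not below `E d / G d`. The chain starts at `A / 1`, whose denominator is
  -- already counted as a unit; this accounts for `A + 1ℤ`.
  ceiling : ℕ → ℤ
  ceiling d = A + 1ℤ - sumTo (λ d → 𝟙 (unit? d)) d

  -- The inequalities `k - 1 < E / G ≤ k`, multiplied by the denominator.
  ceiling-bounds : ∀ d → let k = ceiling (suc d) in
    0ℤ ≤ k * G (suc d) - E (suc d) × 0ℤ ≤ E (suc d) - (k - 1ℤ) * G (suc d) - 1ℤ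
  ceiling-bounds zero rewrite 𝟙-yes (unit? 1) (⇒unit G1) | G1 | E1 =
    ≤-reflexive (sym (ring A)) , ≤-reflexive (sym (ring′ A))
    where
    ring : ∀ A → (A + 1ℤ - (0ℤ + 1ℤ)) * 1ℤ - A ≡ 0ℤ
    ring = solve-∀
    ring′ : ∀ A → A - (A + 1ℤ - (0ℤ + 1ℤ) - 1ℤ) * 1ℤ - 1ℤ ≡ 0ℤ
    ring′ = solve-∀
  ceiling-bounds (suc d) = next (unit? (2 ℕ.+ d))
    where
    k = ceiling (suc d)
    s = sumTo (λ d → 𝟙 (unit? d)) (suc d)
    e = E (suc d)
    g = G (suc d)
    e′ = E (2 ℕ.+ d)
    g′ = G (2 ℕ.+ d)
    ih₁ = proj₁ (ceiling-bounds d)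
    ih₂ = proj₂ (ceiling-bounds d)
    -- The chain decreases strictly, so the next fraction lies strictly below `k`.
    upper : 0ℤ < k * g′ - e′
    upper = pos-factorˡ (G-pos d) (gap≥0⇒< (0≤-resp (ring k e g e′ g′ (adjacent d)) (0≤* (<⇒≤ (G-pos (suc d))) ih₁)))
      where
      ring : ∀ k e g e′ g′ → e * g′ - e′ * g ≡ 1ℤ → g′ * (k * g - e) ≡ g * (k * g′ - e′) - (1ℤ + 0ℤ)
      ring k e g e′ g′ p = trans (lem k e g e′ g′) (cong (λ t → g * (k * g′ - e′) - (t + 0ℤ)) p)
        where
        lem : ∀ k e g e′ g′ → g′ * (k * g - e) ≡ g * (k * g′ - e′) - (e * g′ - e′ * g + 0ℤ)
        lem = solve-∀
    lower-eq : g′ * (e - (k - 1ℤ) * g) - 1ℤ ≡ g * (e′ - (k - 1ℤ) * g′)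
    lower-eq = trans (cong (λ t → g′ * (e - (k - 1ℤ) * g) - t) (sym (adjacent d))) (ring k e g e′ g′)
      where
      ring : ∀ k e g e′ g′ → g′ * (e - (k - 1ℤ) * g) - (e * g′ - e′ * g) ≡ g * (e′ - (k - 1ℤ) * g′)
      ring = solve-∀
    -- A Farey neighbour of a fraction above `k - 1` may reach `k - 1` but cannot jump past it.
    lower : 0ℤ ≤ e′ - (k - 1ℤ) * g′
    lower = nonneg-factorˡ (G-pos d) (0≤-resp (trans (ring g′ (e - (k - 1ℤ) * g)) lower-eq)
      (0≤+ (0≤* (<⇒≤ (G-pos (suc d))) ih₂) (gap≥0 (G-pos (suc d)))))
      where
      ring : ∀ g t → g * (t - 1ℤ) + (g - (1ℤ + 0ℤ)) ≡ g * t - 1ℤ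
      ring = solve-∀
    -- With denominator 1 the new fraction is an integer in the half-open interval from `k - 1` to
    -- `k`, hence equal to `k - 1`, and the ceiling drops. Otherwise the denominator is at least 2,
    -- the value `k - 1` is not attained, and the ceiling stays.
    next : (u : Dec (Unit (2 ℕ.+ d))) →
      0ℤ ≤ (A + 1ℤ - (s + 𝟙 u)) * g′ - e′ × 0ℤ ≤ e′ - (A + 1ℤ - (s + 𝟙 u) - 1ℤ) * g′ - 1ℤ
    next (yes u) = subst (λ g′ → 0ℤ ≤ (A + 1ℤ - (s + 1ℤ)) * g′ - e′ × 0ℤ ≤ e′ - (A + 1ℤ - (s + 1ℤ) - 1ℤ) * g′ - 1ℤ) (sym g′≡1)
      ( 0≤-resp (ring₁ A s e′) (gap≥0 (subst (λ g′ → 0ℤ < k * g′ - e′) g′≡1 upper))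
      , 0≤-resp (ring₂ A s e′) (subst (λ g′ → 0ℤ ≤ e′ - (k - 1ℤ) * g′) g′≡1 lower))
      where
      g′≡1 = unit⇒ u
      ring₁ : ∀ A s e → (A + 1ℤ - s) * 1ℤ - e - (1ℤ + 0ℤ) ≡ (A + 1ℤ - (s + 1ℤ)) * 1ℤ - e
      ring₁ = solve-∀
      ring₂ : ∀ A s e → e - (A + 1ℤ - s - 1ℤ) * 1ℤ ≡ e - (A + 1ℤ - (s + 1ℤ) - 1ℤ) * 1ℤ - 1ℤ
      ring₂ = solve-∀
    next (no ¬u) = 0≤-resp (ring₁ A s e′ g′) (<⇒≤ upper) , 0≤-resp (ring₂ A s e′ g′) (gap≥0 lower-strict)
      where
      1<g′ : 1ℤ < g′
      1<g′ = ≤∧≢⇒< (i<j⇒suc[i]≤j (G-pos (suc d))) λ p → ¬u (⇒unit (sym p))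
      lower-strict : 0ℤ < e′ - (k - 1ℤ) * g′
      lower-strict = pos-factorˡ (G-pos d) (gap≥0⇒< (0≤-resp (trans (ring g′ (e - (k - 1ℤ) * g)) (cong (_- 1ℤ) lower-eq))
        (0≤+ (0≤* (gap≥0 1<g′) (0≤+ ih₂ (+≤+ (ℕ.z≤n {1})))) (0≤+ ih₂ ih₂))))
        where
        ring : ∀ g t → (g - (1ℤ + 1ℤ)) * (t - 1ℤ + 1ℤ) + (t - 1ℤ + (t - 1ℤ)) ≡ g * t - 1ℤ - 1ℤ
        ring = solve-∀
      ring₁ : ∀ A s e g → (A + 1ℤ - s) * g - e ≡ (A + 1ℤ - (s + 0ℤ)) * g - e
      ring₁ = solve-∀
      ring₂ : ∀ A s e g → e - (A + 1ℤ - s - 1ℤ) * g - (1ℤ + 0ℤ) ≡ e - (A + 1ℤ - (s + 0ℤ) - 1ℤ) * g - 1ℤ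
      ring₂ = solve-∀

  unit-ceiling : ∀ d → Unit (suc d) → E (suc d) ≡ ceiling (suc d)
  unit-ceiling d u with ceiling (suc d) | ceiling-bounds d
  ... | k | p , q rewrite unit⇒ u = ≤-antisym (0≤i-j⇒j≤i (0≤-resp (ring₁ k (E (suc d))) p))
                                             (0≤i-j⇒j≤i (0≤-resp (ring₂ k (E (suc d))) q))
    where
    ring₁ : ∀ k e → k * 1ℤ - e ≡ k - e
    ring₁ = solve-∀
    ring₂ : ∀ k e → e - (k - 1ℤ) * 1ℤ - 1ℤ ≡ e - k
    ring₂ = solve-∀

-- Chords and rays read off from the entries

module Parabolic (a : ℤ → ℤ) (L : ℕ) (L≥1 : 1 ℕ.≤ L) (a-periodic : ∀ x → a (x + + L) ≡ a x)
  (D-pos : ∀ x y → x < y → 0ℤ < Recurrence.D a x y)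
  (trace-2 : ∀ x → Recurrence.Periodic.trace a L a-periodic x ≡ + 2) where

  open Recurrence a
  open Periodic L a-periodic

  Chord : ℤ → ℤ → Set
  Chord x y = x < y × D x y ≡ 1ℤ

  chord? : ∀ x y → Dec (Chord x y)
  chord? x y = (x <? y) ×-dec (D x y ≟ 1ℤ)

  x<x+1 : ∀ x → x < x + 1ℤ
  x<x+1 x = x<x+suc x 0

  boundary : ∀ x → Chord x (x + 1ℤ)
  boundary x = x<x+1 x , D-adj x

  x<x+Λ : ∀ x → x < x + Λ
  x<x+Λ x = subst (_< x + Λ) (+-identityʳ x) (shift-< x L≥1)

  chord-shift : ∀ {x y} → Chord x y → Chord (x + Λ) (y + Λ)
  chord-shift {x} {y} (x<y , e) = +-monoˡ-< Λ x<y , trans (D-shift x y) e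

  chord-unshift : ∀ {x y} → Chord (x + Λ) (y + Λ) → Chord x y
  chord-unshift {x} {y} (x<y , e) =
    gap≥0⇒< (0≤-resp (ring x y Λ) (gap≥0 x<y)) , trans (sym (D-shift x y)) e
    where
    ring : ∀ x y l → y + l - (1ℤ + (x + l)) ≡ y - (1ℤ + x)
    ring = solve-∀

  chord-chord : ∀ {x y u v} → Chord x y → Chord u v → x < u → u < y → y < v → ⊥
  chord-chord {x} {y} {u} {v} (_ , e) (_ , e′) x<u u<y y<v = 1≢pos+pos
    (0<* (D-pos x u x<u) (D-pos y v y<v)) (0<* (D-pos x v (<-trans x<u (<-trans u<y y<v))) (D-pos u y u<y))
    (trans (sym (cong₂ _*_ e e′)) (plücker x u y v))

  -- A longer chord would cross its own translate by the period.
  chord-≤ : ∀ {x y} → Chord x y → y ≤ x + Λ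
  chord-≤ {x} {y} c = ≮⇒≥ λ x+L<y → chord-chord c (chord-shift c) (x<x+Λ x) x+L<y (x<x+Λ y)

  rightDegree leftDegree : ℤ → ℕ → ℤ
  rightDegree x = sumTo λ d → 𝟙 (chord? x (x + + d))
  leftDegree x = sumTo λ d → 𝟙 (chord? (x - + d) x)

  x-d<x : ∀ x d → x - + suc d < x
  x-d<x x d = subst (x - + suc d <_) (+-identityʳ x) (shift-back-< x {0} (ℕ.s≤s ℕ.z≤n))

  x-d+d : ∀ x d → x - d + d ≡ x
  x-d+d = solve-∀

  D-succ : ∀ {x y} → y ≡ x + 1ℤ → D x y ≡ 1ℤ
  D-succ {x} y≡ = trans (cong (D x) y≡) (D-adj x)

  -- Plücker's relation for a quadrilateral with two opposite boundary segments as sides.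
  farey : ∀ {x y z w} → y ≡ x + 1ℤ → w ≡ z + 1ℤ → D x z * D y w - D x w * D y z ≡ 1ℤ
  farey {x} {y} {z} {w} y≡ w≡ = begin
    D x z * D y w - D x w * D y z                       ≡⟨ cong (_- D x w * D y z) (plücker x y z w) ⟩
    D x y * D z w + D x w * D y z - D x w * D y z       ≡⟨ cong₂ (λ u v → u * v + D x w * D y z - D x w * D y z) (D-succ y≡) (D-succ w≡) ⟩
    1ℤ * 1ℤ + D x w * D y z - D x w * D y z             ≡⟨ ring (D x w * D y z) ⟩
    1ℤ                                                  ∎
    where
    open ≡-Reasoning
    ring : ∀ v → 1ℤ * 1ℤ + v - v ≡ 1ℤ
    ring = solve-∀

  right-farey : ∀ x d → D (x - 1ℤ) (x + + suc d) * D x (x + + suc (suc d)) - D (x - 1ℤ) (x + + suc (suc d)) * D x (x + + suc d) ≡ 1ℤ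
  right-farey x d = farey (sym (i-1+1≡i x)) (ring x (+ d))
    where
    ring : ∀ x d → x + (+ 2 + d) ≡ x + (1ℤ + d) + 1ℤ
    ring = solve-∀

  left-farey : ∀ x d → D (x - + suc d) (x + 1ℤ) * D (x - + suc (suc d)) x - D (x - + suc (suc d)) (x + 1ℤ) * D (x - + suc d) x ≡ 1ℤ
  left-farey x d = trans (cong (_- D z (x + 1ℤ) * D y x) (*-comm (D y (x + 1ℤ)) (D z x)))
    (farey (ring x (+ d)) refl)
    where
    y = x - + suc d
    z = x - + suc (suc d)
    ring : ∀ x d → x - (1ℤ + d) ≡ x - (+ 2 + d) + 1ℤ
    ring = solve-∀

  module Right (x : ℤ) = FareyChain (λ d → D (x - 1ℤ) (x + + d)) (λ d → D x (x + + d)) (a x)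
    (D-adj x) (D-adj² x) (λ d → D-pos x (x + + suc d) (x<x+suc x d)) (right-farey x)
    (λ d → chord? x (x + + d)) proj₂ (λ {d} e → x<x+suc x d , e)

  module Left (x : ℤ) = FareyChain (λ d → D (x - + d) (x + 1ℤ)) (λ d → D (x - + d) x) (a x)
    (D-succ (sym (i-1+1≡i x))) (D-adj² x) (λ d → D-pos (x - + suc d) x (x-d<x x d)) (left-farey x)
    (λ d → chord? (x - + d) x) proj₂ (λ {d} e → x-d<x x d , e)

  -- Dictated by the degree formula and decidable at once. The geometric meaning is recovered
  -- afterwards: `ray-uncrossed` through the solution `h`, and the converse through `top-triangle`.
  Ray : ℤ → Set
  Ray x = rightDegree x L + leftDegree x L ≡ a x

  ray? : ∀ x → Dec (Ray x)
  ray? x = rightDegree x L + leftDegree x L ≟ a x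

  module Vertex (x : ℤ) where

    R = rightDegree x L
    Lf = leftDegree x L
    W = D x (x + Λ)
    P = D (x - 1ℤ) (x + Λ)
    Q = D (x - Λ) (x + 1ℤ)

    W-pos : 0ℤ < W
    W-pos = D-pos x (x + Λ) (x<x+Λ x)

    W-left : D (x - Λ) x ≡ W
    W-left = trans (sym (D-shift (x - Λ) x)) (cong (λ z → D z (x + Λ)) (x-d+d x Λ))

    -- The trace based at `x - 1ℤ` exchanges `P` for the entry left of `W` in the row of `x`, and
    -- `Q` is a translate of the entry right of `W`; the recurrence adds these two.
    P+Q : P + Q ≡ a x * W + + 2
    P+Q = combine P Q (D x (x + Λ - 1ℤ)) (D x (x + Λ + 1ℤ)) (a x * W) P-trace Q-shift
      (trans (D-solʳ x (x + Λ)) (cong (_* W) (a-periodic x)))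
      where
      swap : ∀ x l → x - 1ℤ + l + 1ℤ ≡ x + l
      swap = solve-∀
      swap′ : ∀ x l → x - 1ℤ + l ≡ x + l - 1ℤ
      swap′ = solve-∀
      swap″ : ∀ x l → x + 1ℤ + l ≡ x + l + 1ℤ
      swap″ = solve-∀
      P-trace : P - D x (x + Λ - 1ℤ) ≡ + 2
      P-trace = trans (sym (cong₂ _-_ (cong (D (x - 1ℤ)) (swap x Λ)) (cong₂ D (i-1+1≡i x) (swap′ x Λ)))) (trace-2 (x - 1ℤ))
      Q-shift : Q ≡ D x (x + Λ + 1ℤ)
      Q-shift = trans (sym (D-shift (x - Λ) (x + 1ℤ))) (cong₂ D (x-d+d x Λ) (swap″ x Λ))
      combine : ∀ P Q u v w → P - u ≡ + 2 → Q ≡ v → u + v ≡ w → P + Q ≡ w + + 2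
      combine P Q u v w e refl refl = trans (lem P u Q) (cong (λ t → u + Q + t) e)
        where
        lem : ∀ P u Q → P + Q ≡ u + Q + (P - u)
        lem = solve-∀

    right-bounds : 0ℤ ≤ (a x + 1ℤ - R) * W - P × 0ℤ ≤ P - (a x + 1ℤ - R - 1ℤ) * W - 1ℤ
    right-bounds = bounds L L≥1
      where
      bounds : ∀ k → 1 ℕ.≤ k → let r = rightDegree x k in
        0ℤ ≤ (a x + 1ℤ - r) * D x (x + + k) - D (x - 1ℤ) (x + + k) ×
        0ℤ ≤ D (x - 1ℤ) (x + + k) - (a x + 1ℤ - r - 1ℤ) * D x (x + + k) - 1ℤ
      bounds (suc k) _ = Right.ceiling-bounds x k

    left-bounds : 0ℤ ≤ (a x + 1ℤ - Lf) * W - Q × 0ℤ ≤ Q - (a x + 1ℤ - Lf - 1ℤ) * W - 1ℤ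
    left-bounds = subst (λ w → 0ℤ ≤ (a x + 1ℤ - Lf) * w - Q × 0ℤ ≤ Q - (a x + 1ℤ - Lf - 1ℤ) * w - 1ℤ) W-left (bounds L L≥1)
      where
      bounds : ∀ k → 1 ℕ.≤ k → let l = leftDegree x k in
        0ℤ ≤ (a x + 1ℤ - l) * D (x - + k) x - D (x - + k) (x + 1ℤ) ×
        0ℤ ≤ D (x - + k) (x + 1ℤ) - (a x + 1ℤ - l - 1ℤ) * D (x - + k) x - 1ℤ
      bounds (suc k) _ = Left.ceiling-bounds x k

    -- The lower bounds say `P ≥ (a x - R) W + 1` and `Q ≥ (a x - Lf) W + 1`. Their two units cancel
    -- the trace in `P+Q`, and `W` can be divided out.
    degree-≥ : a x ≤ R + Lf
    degree-≥ = 0≤i-j⇒j≤i (nonneg-factorˡ W-pos (0≤-resp (ring (a x) R Lf W P Q P+Q) (0≤+ (proj₂ right-bounds) (proj₂ left-bounds))))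
      where
      ring : ∀ a r l w p q → p + q ≡ a * w + + 2 →
        p - (a + 1ℤ - r - 1ℤ) * w - 1ℤ + (q - (a + 1ℤ - l - 1ℤ) * w - 1ℤ) ≡ w * (r + l - a)
      ring a r l w p q e = trans (lem a r l w p q) (trans (cong (λ t → t - + 2 + w * (r + l - + 2 * a)) e) (lem′ a r l w))
        where
        lem : ∀ a r l w p q → p - (a + 1ℤ - r - 1ℤ) * w - 1ℤ + (q - (a + 1ℤ - l - 1ℤ) * w - 1ℤ) ≡ p + q - + 2 + w * (r + l - + 2 * a)
        lem = solve-∀
        lem′ : ∀ a r l w → a * w + + 2 - + 2 + w * (r + l - + 2 * a) ≡ w * (r + l - a)
        lem′ = solve-∀

    -- The upper bounds add up to `a x * W + 2 ≤ (2 * a x + 2 - R - Lf) W`, so `a x + 2 - R - Lf` is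
    -- positive.
    degree-≤ : R + Lf ≤ a x + 1ℤ
    degree-≤ = 0≤i-j⇒j≤i (0≤-resp (ring′ (a x) R Lf) (gap≥0 (pos-factorˡ W-pos
      (gap≥0⇒< (0≤-resp (ring (a x) R Lf W P Q P+Q) (0≤+ (+≤+ (ℕ.z≤n {1})) (0≤+ (proj₁ right-bounds) (proj₁ left-bounds))))))))
      where
      ring′ : ∀ a r l → a + + 2 - (r + l) - (1ℤ + 0ℤ) ≡ a + 1ℤ - (r + l)
      ring′ = solve-∀
      ring : ∀ a r l w p q → p + q ≡ a * w + + 2 →
        1ℤ + ((a + 1ℤ - r) * w - p + ((a + 1ℤ - l) * w - q)) ≡ w * (a + + 2 - (r + l)) - (1ℤ + 0ℤ)
      ring a r l w p q e = trans (lem a r l w p q) (trans (cong (λ t → 1ℤ + ((+ 2 * a + + 2 - (r + l)) * w - t)) e) (lem′ a r l w))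
        where
        lem : ∀ a r l w p q → 1ℤ + ((a + 1ℤ - r) * w - p + ((a + 1ℤ - l) * w - q)) ≡ 1ℤ + ((+ 2 * a + + 2 - (r + l)) * w - (p + q))
        lem = solve-∀
        lem′ : ∀ a r l w → 1ℤ + ((+ 2 * a + + 2 - (r + l)) * w - (a * w + + 2)) ≡ w * (a + + 2 - (r + l)) - (1ℤ + 0ℤ)
        lem′ = solve-∀

    no-ray-degree : ¬ Ray x → R + Lf ≡ a x + 1ℤ
    no-ray-degree ¬r = ≤-antisym degree-≤ (subst (_≤ R + Lf) (+-comm 1ℤ (a x))
      (i<j⇒suc[i]≤j (≤∧≢⇒< degree-≥ λ e → ¬r (sym e))))

    degree : a x ≡ R + Lf - 1ℤ + 𝟙 (ray? x)
    degree with ray? x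
    ... | yes r = trans (sym r) (ring (R + Lf))
      where
      ring : ∀ u → u ≡ u - 1ℤ + 1ℤ
      ring = solve-∀
    ... | no ¬r = trans (ring (a x)) (cong (λ t → t - 1ℤ + 0ℤ) (sym (no-ray-degree ¬r)))
      where
      ring : ∀ u → u ≡ u + 1ℤ - 1ℤ + 0ℤ
      ring = solve-∀

    -- If x lies on a ray, h is the periodic solution with h x = 1.
    h : ℤ → ℤ
    h y = 1ℤ * D (x - 1ℤ) y + - (a x - R) * D x y

    h-sol : Solution h
    h-sol = combination 1ℤ (- (a x - R)) (D-solʳ (x - 1ℤ)) (D-solʳ x)

    h-x : h x ≡ 1ℤ
    h-x = trans (cong₂ (λ u v → 1ℤ * u + - (a x - R) * v)
        (D-succ (sym (i-1+1≡i x))) (D-diag x)) (ring (a x - R))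
      where
      ring : ∀ c → 1ℤ * 1ℤ + - c * 0ℤ ≡ 1ℤ
      ring = solve-∀

    module _ (r : Ray x) where

      -- At a ray the two lower bounds add up to exactly `P + Q`, so both are attained.
      P-ray : P ≡ (a x - R) * W + 1ℤ
      P-ray = ≤-antisym
        (0≤i-j⇒j≤i (0≤-resp (ring (a x) R Lf W P Q r P+Q) (proj₂ left-bounds)))
        (0≤i-j⇒j≤i (0≤-resp (ring′ (a x) R W P) (proj₂ right-bounds)))
        where
        ring′ : ∀ a r w p → p - (a + 1ℤ - r - 1ℤ) * w - 1ℤ ≡ p - ((a - r) * w + 1ℤ)
        ring′ = solve-∀
        ring : ∀ a r l w p q → r + l ≡ a → p + q ≡ a * w + + 2 → q - (a + 1ℤ - l - 1ℤ) * w - 1ℤ ≡ (a - r) * w + 1ℤ - p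
        ring a r l w p q refl e = trans (lem r l w p q) (trans (cong (λ t → t - p - r * w - 1ℤ) e) (lem′ r l w p))
          where
          lem : ∀ r l w p q → q - (r + l + 1ℤ - l - 1ℤ) * w - 1ℤ ≡ p + q - p - r * w - 1ℤ
          lem = solve-∀
          lem′ : ∀ r l w p → (r + l) * w + + 2 - p - r * w - 1ℤ ≡ (r + l - r) * w + 1ℤ - p
          lem′ = solve-∀

      h-x+Λ : h (x + Λ) ≡ 1ℤ
      h-x+Λ = trans (cong (λ u → 1ℤ * u + - (a x - R) * W) P-ray) (ring (a x - R) W)
        where
        ring : ∀ c w → 1ℤ * (c * w + 1ℤ) + - c * w ≡ 1ℤ
        ring = solve-∀

      -- For trace 2, Cayley-Hamilton puts the values at `x - Λ`, `x` and `x + Λ` into arithmetic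
      -- progression, and the last two are 1.
      h-x-Λ : h (x - Λ) ≡ 1ℤ
      h-x-Λ = solve-for (h (x - Λ)) (trans (cong (_+ h (x - Λ)) (sym h-x+Λ)) (trans (cong (λ z → h z + h (x - Λ)) (sym eq)) (trans h-CH (cong (λ z → + 2 * z) (trans (cong h (x-d+d x Λ)) h-x)))))
        where
        y = x - Λ
        eq : y + Λ + Λ ≡ x + Λ
        eq = cong (_+ Λ) (x-d+d x Λ)
        solve-for : ∀ u → 1ℤ + u ≡ + 2 * 1ℤ → u ≡ 1ℤ
        solve-for u e = trans (ring u) (cong (_- 1ℤ) e)
          where
          ring : ∀ u → u ≡ 1ℤ + u - 1ℤ
          ring = solve-∀
        CH : ∀ z → D z (y + Λ + Λ) + D z y ≡ + 2 * D z (y + Λ)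
        CH z = trans (cayley-hamilton z y) (cong (_* D z (y + Λ)) (trace-2 y))
        h-CH : h (y + Λ + Λ) + h y ≡ + 2 * h (y + Λ)
        h-CH = ring (- (a x - R)) (D (x - 1ℤ) (y + Λ + Λ)) (D (x - 1ℤ) y) (D (x - 1ℤ) (y + Λ)) (D x (y + Λ + Λ)) (D x y) (D x (y + Λ)) (CH (x - 1ℤ)) (CH x)
          where
          ring : ∀ c u₂ u₀ u₁ v₂ v₀ v₁ → u₂ + u₀ ≡ + 2 * u₁ → v₂ + v₀ ≡ + 2 * v₁ →
            1ℤ * u₂ + c * v₂ + (1ℤ * u₀ + c * v₀) ≡ + 2 * (1ℤ * u₁ + c * v₁)
          ring c u₂ u₀ u₁ v₂ v₀ v₁ e e′ = trans (lem c u₂ u₀ v₂ v₀) (trans (cong₂ (λ s t → s + c * t) e e′) (lem′ c u₁ v₁))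
            where
            lem : ∀ c u₂ u₀ v₂ v₀ → 1ℤ * u₂ + c * v₂ + (1ℤ * u₀ + c * v₀) ≡ u₂ + u₀ + c * (v₂ + v₀)
            lem = solve-∀
            lem′ : ∀ c u v → + 2 * u + c * (+ 2 * v) ≡ + 2 * (1ℤ * u + c * v)
            lem′ = solve-∀

      -- The three-term relation expresses `D y w * h z` as `D y z + D z w`.
      h-pos : ∀ y z w → h y ≡ 1ℤ → h w ≡ 1ℤ → y < z → z < w → 0ℤ < h z
      h-pos y z w hy hw y<z z<w = pos-factorˡ (D-pos y w (<-trans y<z z<w))
        (subst (0ℤ <_) (sym (trans (three-term h-sol y z w) (trans (cong₂ (λ u v → D y z * u + D z w * v) hw hy)
            (cong₂ _+_ (*-identityʳ (D y z)) (*-identityʳ (D z w))))))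
          (+-mono-< (D-pos y z y<z) (D-pos z w z<w)))

      -- Plücker's relation with `h` in place of the distances to the puncture: a chord over `x`
      -- would make 1 a sum of two positive integers. Its ends lie within one period of `x`, where
      -- `h` is known to be positive.
      ray-uncrossed : ∀ {u v} → Chord u v → u < x → x < v → ⊥
      ray-uncrossed {u} {v} c u<x x<v = 1≢pos+pos
        (0<* (D-pos u x u<x) (h-pos x v (x + Λ) h-x h-x+Λ x<v (≤-<-trans (chord-≤ c) (+-monoˡ-< Λ u<x))))
        (0<* (D-pos x v x<v) (h-pos (x - Λ) u x h-x-Λ h-x x-Λ<u u<x))
        (trans (sym (cong₂ _*_ (proj₂ c) h-x)) (three-term h-sol u x v))
        where
        x-Λ<u : x - Λ < u
        x-Λ<u = gap≥0⇒< (0≤-resp (ring x u Λ) (gap≥0 (<-≤-trans x<v (chord-≤ c))))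
          where
          ring : ∀ x u l → u + l - (1ℤ + x) ≡ u - (1ℤ + (x - l))
          ring = solve-∀

    -- Past the last chord no unit is left to count, so its integer value is already the ceiling
    -- reached after the whole period.
    last-right : ∃[ j ] (Chord x (x + + j) × D (x - 1ℤ) (x + + j) ≡ a x + 1ℤ - R)
    last-right with lastBelow (λ j → chord? x (x + + j)) (suc L) (boundary x) (ℕ.s≤s L≥1)
    ... | zero , () , _
    ... | suc j , _ , j<L , c , none = suc j , c , trans (Right.unit-ceiling x j c)
      (cong (λ t → a x + 1ℤ - t) (sym (sumTo-tail _ (ℕ.≤-pred j<L)
        λ d j<d d≤L → 𝟙-no (chord? x (x + + d)) (none d j<d (ℕ.s≤s d≤L)))))

    last-left : ∃[ j ] (Chord (x - + j) x × D (x - + j) (x + 1ℤ) ≡ a x + 1ℤ - Lf)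
    last-left with lastBelow (λ j → chord? (x - + j) x) (suc L)
        (subst (Chord (x - 1ℤ)) (i-1+1≡i x) (boundary (x - 1ℤ))) (ℕ.s≤s L≥1)
    ... | zero , () , _
    ... | suc j , _ , j<L , c , none = suc j , c , trans (Left.unit-ceiling x j c)
      (cong (λ t → a x + 1ℤ - t) (sym (sumTo-tail _ (ℕ.≤-pred j<L)
        λ d j<d d≤L → 𝟙-no (chord? (x - + d) x) (none d j<d (ℕ.s≤s d≤L)))))

    -- The outermost chords at `x` on both sides have known numerators. Plücker's relation for `w`,
    -- `x`, `x + 1ℤ`, `u` then gives `D w u` as `a x + 2 - (R + Lf)`, which is 1 off the rays.
    top-triangle : ¬ Ray x → ∃[ w ] ∃[ u ] (Chord w x × Chord x u × Chord w u)
    top-triangle ¬r with last-right | last-left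
    ... | j , cu , eu | i , cw , ew = w , u , cw , cu , <-trans (proj₁ cw) (proj₁ cu) , D-wu
      where
      u = x + + j
      w = x - + i
      D-wu : D w u ≡ 1ℤ
      D-wu = ring (a x) R Lf (D w u) (D (x + 1ℤ) u) (no-ray-degree ¬r)
        (trans (sym (cong₂ _*_ ew (proj₂ cu))) (trans (plücker w x (x + 1ℤ) u)
          (cong₂ (λ s t → s * D (x + 1ℤ) u + D w u * t) (proj₂ cw) (D-adj x))))
        (trans (cong (_+ D (x + 1ℤ) u) (sym eu)) (trans (D-solˡ u x) (cong (λ t → a x * t) (proj₂ cu))))
        where
        ring : ∀ a r l d e → r + l ≡ a + 1ℤ → (a + 1ℤ - l) * 1ℤ ≡ 1ℤ * e + d * 1ℤ → a + 1ℤ - r + e ≡ a * 1ℤ → d ≡ 1ℤ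
        ring a r l d e p q s = begin
          d                                            ≡⟨ lem a r d e ⟩
          (1ℤ * e + d * 1ℤ) - (a + 1ℤ - r + e) + (a + 1ℤ - r) ≡⟨ cong₂ (λ u v → u - v + (a + 1ℤ - r)) (sym q) s ⟩
          (a + 1ℤ - l) * 1ℤ - a * 1ℤ + (a + 1ℤ - r)    ≡⟨ lem′ a r l ⟩
          a + + 2 - (r + l)                            ≡⟨ cong (λ t → a + + 2 - t) p ⟩
          a + + 2 - (a + 1ℤ)                           ≡⟨ lem″ a ⟩
          1ℤ                                           ∎
          where
          open ≡-Reasoning
          lem : ∀ a r d e → d ≡ (1ℤ * e + d * 1ℤ) - (a + 1ℤ - r + e) + (a + 1ℤ - r)
          lem = solve-∀
          lem′ : ∀ a r l → (a + 1ℤ - l) * 1ℤ - a * 1ℤ + (a + 1ℤ - r) ≡ a + + 2 - (r + l)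
          lem′ = solve-∀
          lem″ : ∀ a → a + + 2 - (a + 1ℤ) ≡ 1ℤ
          lem″ = solve-∀

  open Vertex using (degree; ray-uncrossed; top-triangle)

  ray-maximal : ∀ x → (∀ {u v} → Chord u v → u < x → x < v → ⊥) → Ray x
  ray-maximal x none = decidable-stable (ray? x) λ ¬r → uncrossed (top-triangle x ¬r)
    where
    uncrossed : ∃[ w ] ∃[ u ] (Chord w x × Chord x u × Chord w u) → ⊥
    uncrossed (w , u , cw , cu , c) = none c (proj₁ cw) (proj₁ cu)

  gap≤L : ∀ {x d} → x + + d ≤ x + Λ → d ℕ.≤ L
  gap≤L {x} p = ℕ.≮⇒≥ λ L<d → <-irrefl refl (<-≤-trans (shift-< x L<d) p)

  -- A pair (x , y) that is not a chord runs into a triangle at x, whose side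
  -- opposite x (a chord or a ray) crosses it.
  module Crossing (x : ℤ) (k : ℕ) (k≤L : k ℕ.≤ L) (not-chord : ¬ Chord x (x + + k))
    (right : ∀ {u v} → Chord u v → x < u → u < x + + k → x + + k < v → ⊥)
    (left : ∀ {u v} → Chord u v → u < x → x < v → v < x + + k → ⊥)
    (no-ray : ∀ {z} → Ray z → x < z → z < x + + k → ⊥)
    (j₀ : ℕ) (j<k : suc j₀ ℕ.< k) (cu : Chord x (x + + suc j₀))
    (none : ∀ i → suc j₀ ℕ.< i → i ℕ.< k → ¬ Chord x (x + + i)) where

    j = suc j₀
    y = x + + k
    u = x + + j

    u<y : u < y
    u<y = shift-< x j<k

    -- The chords from `x` to `u` and to `z` are consecutive, so their numerators differ by one, and
    -- Plücker's relation makes the pair of `u` and `z` a chord. It crosses the pair of `x` and `y`.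
    next-chord : ∀ i → k ℕ.< suc i → Chord x (x + + suc i) → (∀ d → k ℕ.< d → d ℕ.< suc i → ¬ Chord x (x + + d)) → ⊥
    next-chord i k<i cz none′ = right (u<z , D-uz) (proj₁ cu) u<y (shift-< x k<i)
      where
      z = x + + suc i
      u<z : u < z
      u<z = <-trans u<y (shift-< x k<i)
      not-between : ∀ d → j ℕ.< d → d ℕ.< suc i → ¬ Chord x (x + + d)
      not-between d j<d d<i with ℕ.<-cmp d k
      ... | tri< d<k _ _  = none d j<d d<k
      ... | tri≈ _ refl _ = not-chord
      ... | tri> _ _ k<d  = none′ d k<d d<i
      count : rightDegree x (suc i) ≡ rightDegree x j + 1ℤ
      count = sumTo-last (λ d → 𝟙 (chord? x (x + + d))) (ℕ.<-trans j<k k<i) (𝟙-yes (chord? x z) cz)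
        λ d j<d d<i → 𝟙-no (chord? x (x + + d)) (not-between d j<d d<i)
      D-uz : D u z ≡ 1ℤ
      D-uz = ring (a x + 1ℤ) (rightDegree x j) (D u z) (begin
        (a x + 1ℤ - rightDegree x j) * 1ℤ                 ≡⟨ sym (cong₂ _*_ (Right.unit-ceiling x j₀ cu) (proj₂ cz)) ⟩
        D (x - 1ℤ) u * D x z                              ≡⟨ plücker (x - 1ℤ) x u z ⟩
        D (x - 1ℤ) x * D u z + D (x - 1ℤ) z * D x u       ≡⟨ cong₂ (λ s t → s * D u z + t * D x u) (D-succ (sym (i-1+1≡i x)))
                                                               (trans (Right.unit-ceiling x i cz) (cong (λ t → a x + 1ℤ - t) count)) ⟩
        1ℤ * D u z + (a x + 1ℤ - (rightDegree x j + 1ℤ)) * D x u ≡⟨ cong (λ t → 1ℤ * D u z + (a x + 1ℤ - (rightDegree x j + 1ℤ)) * t) (proj₂ cu) ⟩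
        1ℤ * D u z + (a x + 1ℤ - (rightDegree x j + 1ℤ)) * 1ℤ ∎)
        where
        open ≡-Reasoning
        ring : ∀ c s d → (c - s) * 1ℤ ≡ 1ℤ * d + (c - (s + 1ℤ)) * 1ℤ → d ≡ 1ℤ
        ring c s d e = trans (lem c s d) (trans (cong (_- (c - (s + 1ℤ)) * 1ℤ) (sym e)) (lem′ c s))
          where
          lem : ∀ c s d → d ≡ 1ℤ * d + (c - (s + 1ℤ)) * 1ℤ - (c - (s + 1ℤ)) * 1ℤ
          lem = solve-∀
          lem′ : ∀ c s → (c - s) * 1ℤ - (c - (s + 1ℤ)) * 1ℤ ≡ 1ℤ
          lem′ = solve-∀

    module _ (none′ : ∀ i → k ℕ.< i → i ℕ.≤ L → ¬ Chord x (x + + i)) where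

      ends-before : ∀ i → Chord x (x + + i) → i ℕ.< k
      ends-before i c with ℕ.<-cmp i k
      ... | tri< i<k _ _  = i<k
      ... | tri≈ _ refl _ = ⊥-elim (not-chord c)
      ... | tri> _ _ k<i  = ⊥-elim (none′ i k<i (gap≤L {x} (chord-≤ c)) c)

      inner : ∀ {v} → Chord x v → v < y
      inner {v} c with <-gap (proj₁ c)
      ... | i , refl = shift-< x (ends-before (suc i) c)

      beyond : ∀ {v} → Chord x v → u < v → ⊥
      beyond {v} c u<v with <-gap (proj₁ c)
      ... | i , refl = none (suc i) (unshift-< x u<v) (ends-before (suc i) c) c

      -- Here `u` ends the last chord from `x`. The third side of a top triangle at `u` would pass
      -- over the ray at `x`, cross the chord from `x` to `u`, or be a later chord from `x`.
      next-ray : Ray x → Ray u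
      next-ray rx = decidable-stable (ray? u) λ ¬ru → crossed (top-triangle u ¬ru)
        where
        crossed : ∃[ w ] ∃[ v ] (Chord w u × Chord u v × Chord w v) → ⊥
        crossed (w , v , cw , cv , c) with <-cmp w x
        ... | tri< w<x _ _  = ray-uncrossed x rx c w<x (<-trans (proj₁ cu) (proj₁ cv))
        ... | tri> _ _ x<w  = chord-chord cu c x<w (proj₁ cw) (proj₁ cv)
        ... | tri≈ _ refl _ = beyond c (proj₁ cv)

      -- A ray at `x` would put one at `u`, strictly below the pair. So `x` has a top triangle, and
      -- its third side ends before `y` and crosses the pair from the left.
      last-chord : ⊥
      last-chord = crossed (top-triangle x λ r → no-ray (next-ray r) (proj₁ cu) u<y)
        where
        crossed : ∃[ w ] ∃[ v ] (Chord w x × Chord x v × Chord w v) → ⊥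
        crossed (w , v , cw , cv , c) = left c (proj₁ cw) (proj₁ cv) (inner cv)

    contradiction : ⊥
    contradiction with L ℕ.∸ k | ℕ.m+[n∸m]≡n k≤L
    ... | r | k+r≡L with firstAbove (λ i → chord? x (x + + i)) k r
    ...   | inj₁ (suc i , k<i , _ , c , none′) = next-chord i k<i c none′
    ...   | inj₂ none′ = last-chord λ i k<i i≤L → none′ i k<i (subst (i ℕ.≤_) (sym k+r≡L) i≤L)

  chord-maximal : ∀ x y → x < y → y ≤ x + Λ →
    (∀ {u v} → Chord u v → x < u → u < y → y < v → ⊥) →
    (∀ {u v} → Chord u v → u < x → x < v → v < y → ⊥) →
    (∀ {z} → Ray z → x < z → z < y → ⊥) → Chord x y
  chord-maximal x y x<y y≤x+Λ right left no-ray = by-gap (<-gap x<y)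
    where
    by-gap : ∃[ k ] y ≡ x + + suc k → Chord x y
    by-gap (zero  , refl) = boundary x
    by-gap (suc k , refl) with chord? x y
    ... | yes c = c
    ... | no ¬c with lastBelow (λ j → chord? x (x + + j)) (suc (suc k)) (boundary x) (ℕ.s≤s (ℕ.s≤s ℕ.z≤n))
    ...   | suc j , _ , j<k , cu , none =
      ⊥-elim (Crossing.contradiction x (suc (suc k)) (gap≤L {x} y≤x+Λ) ¬c right left no-ray j j<k cu none)

  chord-𝟙-shift : ∀ x y → 𝟙 (chord? (x + Λ) (y + Λ)) ≡ 𝟙 (chord? x y)
  chord-𝟙-shift x y = 𝟙-cong (chord? (x + Λ) (y + Λ)) (chord? x y) chord-unshift chord-shift

  rightDegree-shift : ∀ x → rightDegree (x + Λ) L ≡ rightDegree x L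
  rightDegree-shift x = sumTo-cong L λ d _ _ →
    trans (cong (λ z → 𝟙 (chord? (x + Λ) z)) (swap x Λ (+ d))) (chord-𝟙-shift x (x + + d))
    where
    swap : ∀ x l d → x + l + d ≡ x + d + l
    swap = solve-∀

  leftDegree-shift : ∀ x → leftDegree (x + Λ) L ≡ leftDegree x L
  leftDegree-shift x = sumTo-cong L λ d _ _ →
    trans (cong (λ z → 𝟙 (chord? z (x + Λ))) (swap x Λ (+ d))) (chord-𝟙-shift (x - + d) x)
    where
    swap : ∀ x l d → x + l - d ≡ x - d + l
    swap = solve-∀

  degrees-shift : ∀ x → rightDegree (x + Λ) L + leftDegree (x + Λ) L ≡ rightDegree x L + leftDegree x L
  degrees-shift x = cong₂ _+_ (rightDegree-shift x) (leftDegree-shift x)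

  periodicTriangulation : PeriodicTriangulation L a
  periodicTriangulation = record
    { Chord = Chord ; Ray = Ray ; chord? = chord? ; ray? = ray?
    ; chord-< = proj₁
    ; chord-≤ = chord-≤
    ; boundary = boundary
    ; chord-shift = chord-shift
    ; chord-unshift = chord-unshift
    ; ray-shift = λ {x} r → trans (degrees-shift x) (trans r (sym (a-periodic x)))
    ; ray-unshift = λ {x} r → trans (sym (degrees-shift x)) (trans r (a-periodic x))
    ; chord-chord = chord-chord
    ; chord-ray = λ {_} {_} {z} c r → ray-uncrossed z r c
    ; chord-maximal = chord-maximal
    ; ray-maximal = ray-maximal
    ; degree = degree
    }

-- Trace 2 and punctured discs: the two implications

parabolic⇒punctured-disc : ∀ F n → IsMinimalPeriod F n → (∀ k → growth F n k ≡ + 2) → ArisesFromPuncturedDisc F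
parabolic⇒punctured-disc F n (n-period , _) all-2 = n , nz , triangulation , 0ℤ , λ t i → begin
  quiddityRow F (0ℤ + + toℕ i + t * + n)              ≡⟨ cong (λ z → quiddityRow F (z + t * + n)) (+-identityˡ (+ toℕ i)) ⟩
  quiddityRow F (point i t)                           ≡⟨ regionsAt-triangulation (point i t) ⟩
  + regionsAt triangulation (residue (point i t))     ≡⟨ cong (λ j → + regionsAt triangulation j) (residue-point i t) ⟩
  + regionsAt triangulation i                         ∎
  where
  open ≡-Reasoning
  open Frieze F
  instance
    nz : ℕ.NonZero n
    nz = ℕ.>-nonZero (proj₁ n-period)
  periodic = a-periodic n n-period
  trace-2 : ∀ x → Periodic.trace n periodic x ≡ + 2
  trace-2 x = trans (Periodic.trace-const n periodic x 0ℤ) (trans (sym (growth-1 n n-period)) (all-2 1))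
  open MarkedPoints n
  open Correspondence.ToTriangulation n
    (Parabolic.periodicTriangulation a n (proj₁ n-period) periodic D-pos trace-2)

-- The witness is the number `N` of marked points: `N * n` is a multiple of `N` and of `n`, so the
-- trace over this length is governed by the triangulation and is also a growth coefficient.
punctured-disc⇒parabolic : ∀ F n → IsMinimalPeriod F n → ArisesFromPuncturedDisc F → ∃[ k ] (k > 0 × growth F n k ≡ + 2)
punctured-disc⇒parabolic F n (n-period , _) (suc N₀ , nz , T , origin , quiddity) = N , ℕ.s≤s ℕ.z≤n ,
  -- The existence of a ray is known in double negated form, which suffices for a decidable
  -- equality.
  decidable-stable (growth F n N ≟ + 2) λ ≢2 → some-ray λ x r → ≢2 (growth-2 x r)
  where
  open Frieze F
  N = suc N₀
  l = N ℕ.* n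
  L = + l
  open MarkedPoints N {{nz}}
  b : ℤ → ℤ
  b x = + regionsAt {{nz}} T (residue x)
  open Correspondence.FromTriangulation N {{nz}} T
  open PeriodicTriangulation periodicTriangulation using () renaming (Ray to Ray′)
  open Telescoping periodicTriangulation
  periodic = a-periodic* n n-period N
  b≡a : ∀ x → b x ≡ a (origin + x)
  b≡a x = sym (trans (cong a (trans (cong (λ z → origin + z) (sym (point-residue x)))
    (sym (+-assoc origin _ _)))) (quiddity (turns x) (residue x)))
  -- The quiddity sequence begins at `origin`, so rows of `D` solve the recurrence of the
  -- triangulation after this translation.
  D-from : ∀ z → Recurrence.Solution b (λ x → D z (origin + x))
  D-from z x = begin
    D z (origin + (x - 1ℤ)) + D z (origin + (x + 1ℤ)) ≡⟨ cong₂ (λ u v → D z u + D z v) (sym (+-assoc origin x (- 1ℤ))) (sym (+-assoc origin x 1ℤ)) ⟩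
    D z (origin + x - 1ℤ) + D z (origin + x + 1ℤ)     ≡⟨ D-solʳ z (origin + x) ⟩
    a (origin + x) * D z (origin + x)                 ≡⟨ cong (_* D z (origin + x)) (sym (b≡a x)) ⟩
    b x * D z (origin + x)                            ∎
    where open ≡-Reasoning
  growth-2 : ∀ x → Ray x → growth F n N ≡ + 2
  -- The row of `y` vanishes at `y`, so the progression gives `w₂ = 2 * w₁`, while Cayley-Hamilton
  -- gives `w₂ = tr * w₁`; the positive `w₁` cancels.
  growth-2 x r = trans (growth≡trace n n-period N₀ y) (cancelˡ-pos {w₁} w₁-pos
      (trans (*-comm w₁ tr) (trans (sym (Periodic.cayley-hamilton l periodic y y)) double)))
    where
    y = origin + x
    tr = Periodic.trace l periodic y
    w₁ = D y (y + L)
    w₂ = D y (y + L + L)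
    w₁-pos : 0ℤ < w₁
    w₁-pos = D-pos y (y + L) (subst (_< y + L) (+-identityʳ y)
      (shift-< y (ℕ.*-mono-≤ {1} {N} {1} {n} (ℕ.s≤s ℕ.z≤n) (proj₁ n-period))))
    progression : w₂ - w₁ ≡ w₁ - D y y
    -- The triangulation is traversed in `n` turns of `N` marked points, the frieze in `N` periods
    -- of length `n`.
    progression = subst₂ (λ u v → D y v - D y u ≡ D y u - D y y) (sym (+-assoc origin x L))
      (ring origin x L) (subst (λ t → D y (origin + (x + + t + + t)) - D y (origin + (x + + t)) ≡ D y (origin + (x + + t)) - D y y)
        (ℕ.*-comm n N) (arithmetic-progression (D-from y) n x r))
      where
      ring : ∀ o x l → o + (x + l + l) ≡ o + x + l + l
      ring = solve-∀
    double : w₂ + D y y ≡ w₁ * + 2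
    double = ring w₁ w₂ (D y y) (D-diag y) progression
      where
      ring : ∀ u v z → z ≡ 0ℤ → v - u ≡ u - z → v + z ≡ u * + 2
      ring u v z refl e = trans (lem u v) (trans (cong (λ t → t + u) e) (lem′ u))
        where
        lem : ∀ u v → v + 0ℤ ≡ v - u + u
        lem = solve-∀
        lem′ : ∀ u → u - 0ℤ + u ≡ u * + 2
        lem′ = solve-∀

proposition4p4 : (F : InfiniteFrieze) (n : ℕ) → IsMinimalPeriod F n →
    ((∃[ k ] (k > 0 × growth F n k ≡ + 2)) ⇔ (∀ k → growth F n k ≡ + 2)) ×
    ((∀ k → growth F n k ≡ + 2) ⇔ ArisesFromPuncturedDisc F)
proposition4p4 F n minimal@(n-period , _) =
  mk⇔ once⇒always (λ all → 1 , ℕ.s≤s ℕ.z≤n , all 1) ,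
  mk⇔ (parabolic⇒punctured-disc F n minimal)
      (λ disc → once⇒always (punctured-disc⇒parabolic F n minimal disc))
  where
  once⇒always : ∃[ k ] (k > 0 × growth F n k ≡ + 2) → ∀ k → growth F n k ≡ + 2
  once⇒always (k , k>0 , e) = Frieze.growth-2-if-once F n n-period k k>0 e
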